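{- Let $G$ be a circulant graph with property $Q$ and let $H$ be any Hamilton cycle decomposable (loopless) multigraph. Then the tensor product $G\times H$ is Hamilton cycle decomposable.
   Context: A circulant $X=Circ(n;L)$, with $L\subseteq\{1,2,\ldots,\lfloor n/2\rfloor\}$ (the elements of $L$ are called jumps), has vertex set $\{u_0,\ldots,u_{n-1}\}$ and edge set $\{u_iu_{i+\ell}: i\in\mathbb{Z}_n,\ \ell\in L\}$ (indices mod $n$). An even regular circulant graph $X=Circ(n;L)$ has property $Q$ if (1) the number of odd jumps and the number of even jumps in $L$ are equal, and (2) the odd jumps can be paired with the even jumps so that each of the $|L|/2$ resulting $4$-regular circulant graphs $Circ(n;\{\ell,\ell'\})$ ($\ell$ odd, $\ell'$ even, a pair) is connected. A Hamilton cycle decomposition of a (multi)graph is a partition of its edge set into Hamilton cycles. For a multigraph $H$ (an edge may have multiplicity), the tensor product $G\times H$ has vertex set $V(G)\times V(H)$; for each edge $g_1g_2$ of $G$ and each edge $h_1h_2$ of $H$ of multiplicity $\mu$, there are edges $(g_1,h_1)(g_2,h_2)$ and $(g_1,h_2)(g_2,h_1)$, each of multiplicity $\mu$; for simple graphs, $(g_1,h_1)$ and $(g_2,h_2)$ are adjacent iff $g_1g_2\in E(G)$ and $h_1h_2\in E(H)$. -}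

module Defs where

open import Data.Nat using (ℕ; zero; suc; _+_; _*_; _≤_; _<_)
import Data.Nat as ℕ
open import Data.Nat.DivMod using (_%_; m%n<n)
open import Data.Bool using (Bool; true; false; if_then_else_; _∧_; _∨_)
open import Data.Fin using (Fin; toℕ; fromℕ<)
import Data.Fin as Fin
open import Data.List using (List; []; _∷_; map; _++_)
open import Data.Nat.ListAction using (sum)
open import Data.List.Membership.Propositional using (_∈_)
open import Data.List.Relation.Unary.Any using (Any; any?)
open import Data.List.Relation.Unary.Unique.Propositional using (Unique)
open import Data.List.Relation.Binary.Permutation.Propositional using (_↭_)
open import Data.Product using (Σ; _×_; _,_; proj₁; proj₂; ∃)
open import Data.Sum using (_⊎_)
open import Function.Bundles using (_⤖_; Bijection)
open import Relation.Binary.PropositionalEquality using (_≡_; _≢_)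
open import Relation.Binary.Definitions using (DecidableEquality)
open import Relation.Binary.Construct.Closure.ReflexiveTransitive using (Star)
open import Relation.Nullary using (Dec; does; ¬_)
open import Relation.Nullary.Decidable using (_⊎-dec_; _×-dec_)

-- Circulant graphs Circ(n; L) on vertex set Fin n (u_i ↦ i).
-- Jumps are natural numbers ℓ with 1 ≤ ℓ ≤ ⌊n/2⌋, so for i, j < n,
-- "j ≡ i + ℓ (mod n)" is exactly  i + ℓ ≡ j  or  i + ℓ ≡ j + n.

JumpStep : (n ℓ : ℕ) → Fin n → Fin n → Set
JumpStep n ℓ i j = (toℕ i + ℓ ≡ toℕ j) ⊎ (toℕ i + ℓ ≡ toℕ j + n)

CircAdj : (n : ℕ) → List ℕ → Fin n → Fin n → Set
CircAdj n L i j = Any (λ ℓ → JumpStep n ℓ i j ⊎ JumpStep n ℓ j i) L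

circAdj? : (n : ℕ) (L : List ℕ) (i j : Fin n) → Dec (CircAdj n L i j)
circAdj? n L i j = any? (λ ℓ → step ℓ i j ⊎-dec step ℓ j i) L
  where
  step : (ℓ : ℕ) (a b : Fin n) → Dec (JumpStep n ℓ a b)
  step ℓ a b = (toℕ a + ℓ ℕ.≟ toℕ b) ⊎-dec (toℕ a + ℓ ℕ.≟ toℕ b + n)

circMult : (n : ℕ) → List ℕ → Fin n → Fin n → ℕ
circMult n L i j = if does (circAdj? n L i j) then 1 else 0

IsJumpSet : ℕ → List ℕ → Set
IsJumpSet n L = Unique L × (∀ {ℓ} → ℓ ∈ L → 1 ≤ ℓ × 2 * ℓ ≤ n)

-- Circ(n;L) is even regular (degree 2|L|): no jump equals n/2
EvenRegular : ℕ → List ℕ → Set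
EvenRegular n L = ∀ {ℓ} → ℓ ∈ L → 2 * ℓ ≢ n

CircConnected : ℕ → List ℕ → Set
CircConnected n L = ∀ (i j : Fin n) → Star (CircAdj n L) i j

Odd Even : ℕ → Set
Odd ℓ = ℓ % 2 ≡ 1
Even ℓ = ℓ % 2 ≡ 0

-- Property Q: the jumps can be split into pairs (odd, even) — so there are
-- equally many odd and even jumps — with every Circ(n;{ℓ,ℓ'}) connected.
PropertyQ : ℕ → List ℕ → Set
PropertyQ n L =
  Σ (List (ℕ × ℕ)) λ P →
      ((map proj₁ P ++ map proj₂ P) ↭ L)
    × (∀ {p} → p ∈ P →
         Odd (proj₁ p) × Even (proj₂ p)
       × CircConnected n (proj₁ p ∷ proj₂ p ∷ []))

-- Multigraphs are given by multiplicity functions μ : V → V → ℕ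
-- (μ u v = number of edges joining u and v).

-- A Hamilton cycle through the vertex set V: a cyclic ordering
-- σ : Fin (suc k) ⤖ V of all vertices; its edges are σ i σ (i+1 mod k+1).
record HamCycle (V : Set) : Set where
  field
    k : ℕ
    ord : Fin (suc k) ⤖ V

  σ : Fin (suc k) → V
  σ = Bijection.to ord

  next : Fin (suc k) → Fin (suc k)
  next i = fromℕ< (m%n<n (suc (toℕ i)) (suc k))

countFin : ∀ {k} → (Fin k → Bool) → ℕ
countFin {zero} f = 0
countFin {suc k} f = (if f Fin.zero then 1 else 0) + countFin (λ i → f (Fin.suc i))

cycleMult : {V : Set} → DecidableEquality V → HamCycle V → V → V → ℕ
cycleMult _≟_ C u v =
  countFin (λ i → (does (σ i ≟ u) ∧ does (σ (next i) ≟ v))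
                ∨ (does (σ i ≟ v) ∧ does (σ (next i) ≟ u)))
  where open HamCycle C

HCDecomposable : {V : Set} → DecidableEquality V → (V → V → ℕ) → Set
HCDecomposable {V} _≟_ μ =
  Σ (List (HamCycle V)) λ Cs →
    ∀ u v → sum (map (λ C → cycleMult _≟_ C u v) Cs) ≡ μ u v

tensor : {A B : Set} → (A → A → ℕ) → (B → B → ℕ) → (A × B) → (A × B) → ℕ
tensor μG μH (g₁ , h₁) (g₂ , h₂) = μG g₁ g₂ * μH h₁ h₂

{-# OPTIONS --safe #-}
module Submission where

open import Defs
open import Data.Nat using (ℕ; zero; suc; pred; _+_; _*_; _∸_; _≤_; _<_; z≤n; s≤s; z<s; >-nonZero; _≤?_; _<?_)
open import Data.Nat.Properties hiding (_≟_)
open import Data.Nat.DivMod using (_%_; _/_; m%n<n; m≡m%n+[m/n]*n; /-monoˡ-≤; m<n⇒m%n≡m; n%n≡0; m%n%n≡m%n; [m+n]%n≡m%n; %-distribˡ-+; %-distribˡ-*; m∣n⇒o%n%m≡o%m; m*n%n≡0)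
open import Data.Nat.Divisibility using (_∣_; divides; ∣-trans; m%n≡0⇒n∣m; n∣m⇒m%n≡0)
open import Data.Nat.GeneralisedArithmetic using (fold; fold-+)
open import Data.Nat.ListAction using (sum)
open import Data.Nat.ListAction.Properties using (sum-++; sum-↭)
open import Data.Nat.Tactic.RingSolver using (solve-∀)
open import Data.Bool using (Bool; true; false; if_then_else_; not; _∧_; _∨_)
import Data.Bool as Bool
open import Data.Bool.Properties using (not-¬; ¬-not; not-involutive)
open import Data.Fin using (Fin; toℕ; fromℕ<; zero; suc; combine; _≟_)
import Data.Fin.Properties as Fin
open import Data.List using (List; []; _∷_; map; _++_)
open import Data.List.Properties using (map-++)
open import Data.List.Membership.Propositional using (_∈_)
open import Data.List.Membership.Propositional.Properties using (∈-map⁺; ∈-++⁺ˡ; ∈-++⁺ʳ)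
open import Data.List.Relation.Unary.Any using (here; there)
open import Data.List.Relation.Unary.All using (lookup)
open import Data.List.Relation.Unary.AllPairs using (_∷_)
open import Data.List.Relation.Unary.Unique.Propositional using (Unique)
open import Data.List.Relation.Binary.Permutation.Propositional.Properties using (∈-resp-↭; map⁺)
open import Data.Product using (Σ; _×_; _,_; proj₁; proj₂; ∃; ∃₂)
open import Data.Product.Properties using (≡-dec)
open import Data.Sum using (_⊎_; inj₁; inj₂)
open import Data.Empty using (⊥; ⊥-elim)
open import Function using (_∘_; id)
open import Function.Bundles using (_↣_; _↔_; _⤖_; Inverse; Injection; Bijection; mk↔ₛ′; mk⇔; mk⤖; mk↣)
open import Function.Construct.Symmetry using (↔-sym)
open import Level using (0ℓ)
open import Relation.Nullary using (¬_; Dec; yes; no; contradiction; does)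
open import Relation.Nullary.Decidable using (via-injection; does-⇔; dec-true; dec-false)
open import Relation.Unary using (Pred; Decidable)
open import Relation.Binary.Definitions using (DecidableEquality; tri<; tri≈; tri>)
open import Relation.Binary.PropositionalEquality
open import Relation.Binary.Construct.Closure.ReflexiveTransitive using (Star; ε; _◅_; _◅◅_)
import Relation.Binary.Construct.Closure.ReflexiveTransitive as Star
open import Relation.Binary.Construct.Closure.Equivalence as EqC using (EqClosure)
open import Relation.Binary.Construct.Closure.Symmetric using (fwd; bwd)

-- A Hamilton cycle of H arranges G × H in cyclically ordered layers Fin n, with edges g → g ± a,
-- g ± b from each layer to the next. It suffices to split these edges, for every pair (a , b), into
-- four sequences of permutations (one per layer) whose composites around the cycle are n-cycles.
-- Pairs of consecutive layers carrying a permutation and its inverse cancel, so only m = 2 and m = 3 matter.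
--
-- m = 3: split Circ(n;{a,b}) into a Hamilton cycle f and any oriented 2-factor v. The layers
-- (f, f⁻¹, v⁻¹, v), (f⁻¹, v, f, v⁻¹), (f, v⁻¹, v, f⁻¹) have composites conjugate to f or f⁻¹.
-- m = 2: split the bipartite double Γ of Circ(n;{a,b}) into two Hamilton cycles and use each of
-- them in both directions.
--
-- Both splittings start from the orbits of b ("rows", D of them) and the orbits of a ("columns", W of
-- them) in the toroidal grid pt i j = ia + jb, and exchange the edges of one square between each two
-- consecutive rows. This always joins the rows to one cycle. In Γ, D and W have the same parity, and
-- for W ≤ D the squares can be placed so that the columns are joined to one cycle as well.

-- Using one n-cycle `f` in all m layers would give the m-th power of `f`, which splits into gcd(m,
-- n) orbits; hence layers have to be mixed so that all but one factor cancels. Three layers leave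
-- room for this. Two in general do not: a permutation from layer 0 to layer 1 followed by one back
-- amounts to a permutation of Γ that switches sides, and the composite has a single orbit exactly
-- when that permutation has. So for m = 2 both factors must be Hamiltonian at once. Here it matters
-- that one jump is odd and the other even: a + b is odd, which makes Γ connected, and the numbers
-- of rows and columns are both even for even n, while for odd n both divide n. The parity enters
-- through the zigzag of squares. Along three neighbouring lines it acts like three strands: two
-- lower ends are tied together, two upper ends are tied together, and a third strand runs from the
-- remaining lower end to the remaining upper end. Its length fixes which ends are tied. With at
-- least two columns the right parity closes the strands into one cycle, and the other parity would
-- leave two.

private
  variable
    X : Set
    N : ℕ

-- Orbits of two commuting permutations

fold-comm : (f g : X → X) → (∀ x → f (g x) ≡ g (f x)) → ∀ i x → fold (g x) f i ≡ g (fold x f i)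
fold-comm f g fg zero    x = refl
fold-comm f g fg (suc i) x = trans (cong f (fold-comm f g fg i x)) (fg _)

fold-comm₂ : (f g : X → X) → (∀ x → f (g x) ≡ g (f x)) → ∀ i j x → fold (fold x g j) f i ≡ fold (fold x f i) g j
fold-comm₂ f g fg i zero    x = refl
fold-comm₂ f g fg i (suc j) x = trans (fold-comm f g fg i _) (cong g (fold-comm₂ f g fg i j x))

fold-suc : (f : X → X) → ∀ i x → fold (f x) f i ≡ fold x f (suc i)
fold-suc f i x = fold-comm f f (λ _ → refl) i x

fold-injective : (f : X → X) → (∀ {x y} → f x ≡ f y → x ≡ y) → ∀ i {x y} → fold x f i ≡ fold y f i → x ≡ y
fold-injective f inj zero    e = e
fold-injective f inj (suc i) e = fold-injective f inj i (inj e)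

least : {P : Pred ℕ 0ℓ} → Decidable P → ∀ {n} → P n → ∃ λ m → P m × (∀ {k} → k < m → ¬ P k)
least {P} P? {n} pn with search (suc n)
  where
  search : ∀ n → (∃ λ m → P m × (∀ {k} → k < m → ¬ P k)) ⊎ (∀ {k} → k < n → ¬ P k)
  search zero    = inj₂ λ ()
  search (suc n) with search n
  ... | inj₁ found = inj₁ found
  ... | inj₂ none with P? n
  ...   | yes pn = inj₁ (n , pn , none)
  ...   | no ¬pn = inj₂ λ k<1+n → case (m≤n⇒m<n∨m≡n (≤-pred k<1+n))
    where
    case : ∀ {k} → k < n ⊎ k ≡ n → ¬ P k
    case (inj₁ k<n)  = none k<n
    case (inj₂ refl) = ¬pn
... | inj₁ found = found
... | inj₂ none  = contradiction pn (none (n<1+n n))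

InjectiveBelow : ℕ → (ℕ → X) → Set
InjectiveBelow j w = ∀ {a b} → a < b → b < j → w a ≢ w b

injectiveBelow⇒≡ : ∀ {j} {w : ℕ → X} → InjectiveBelow j w → ∀ {a b} → a < j → b < j → w a ≡ w b → a ≡ b
injectiveBelow⇒≡ inj {a} {b} a<j b<j eq with <-cmp a b
... | tri< a<b _ _ = contradiction eq (inj a<b b<j)
... | tri≈ _ a≡b _ = a≡b
... | tri> _ _ b<a = contradiction (sym eq) (inj b<a a<j)

-- The pigeonhole principle gives some repetition, and taking the least `j` makes the earlier terms
-- distinct. It serves orbits of permutations as well as walks in graphs.
first-repeat : X ↣ Fin N → (w : ℕ → X) → ∃ λ j → (∃ λ i → i < j × w i ≡ w j) × InjectiveBelow j w
first-repeat {X} {N} enc w =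
  let (j , rep , first) = least (λ j → anyUpTo? (λ i → w i ≐ w j) j) repetition
  in j , rep , λ a<b b<j eq → first b<j (_ , a<b , eq)
  where
  _≐_ = via-injection enc Fin._≟_
  repetition : ∃ λ i → i < _ × w i ≡ w _
  repetition =
    let (a , b , a<b , eq) = Fin.pigeonhole (n<1+n N) (λ (k : Fin (suc N)) → Injection.to enc (w (toℕ k)))
    in toℕ a , a<b , Injection.injective enc eq

-- Injectivity cancels one application of `f` from a repetition at a positive index, so the first
-- repeated value can only be `x` itself.
order : X ↣ Fin N → (f : X → X) → (∀ {x y} → f x ≡ f y → x ≡ y) → ∀ x →
        ∃ λ p → fold x f (suc p) ≡ x × InjectiveBelow (suc p) (fold x f)
order enc f inj x = first-return (first-repeat enc (fold x f))
  where
  first-return : (∃ λ j → (∃ λ i → i < j × fold x f i ≡ fold x f j) × InjectiveBelow j (fold x f)) →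
                 ∃ λ p → fold x f (suc p) ≡ x × InjectiveBelow (suc p) (fold x f)
  first-return (suc j , (zero  , i<j , eq) , below) = j , sym eq , below
  first-return (suc j , (suc i , i<j , eq) , below) = contradiction (inj eq) (below (≤-pred i<j) (n<1+n j))

module Torus {X : Set} {N : ℕ} (enc : X ↣ Fin N) (α β : X ↔ X) where
  open Inverse α using () renaming (to to A; from to A⁻; strictlyInverseˡ to AA⁻; strictlyInverseʳ to A⁻A) public
  open Inverse β using () renaming (to to B; from to B⁻; strictlyInverseˡ to BB⁻; strictlyInverseʳ to B⁻B) public

  _≐_ = via-injection enc Fin._≟_

  data Step (x : X) : X → Set where
    fwdA : Step x (A x)
    bwdA : Step x (A⁻ x)
    fwdB : Step x (B x)
    bwdB : Step x (B⁻ x)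

  A-inj : ∀ {x y} → A x ≡ A y → x ≡ y
  A-inj {x} {y} e = trans (sym (A⁻A x)) (trans (cong A⁻ e) (A⁻A y))

  B-inj : ∀ {x y} → B x ≡ B y → x ≡ y
  B-inj {x} {y} e = trans (sym (B⁻B x)) (trans (cong B⁻ e) (B⁻B y))

  module Commuting (comm : ∀ x → A (B x) ≡ B (A x)) where

    A⁻B : ∀ x → A⁻ (B x) ≡ B (A⁻ x)
    A⁻B x = A-inj (trans (AA⁻ _) (trans (cong B (sym (AA⁻ x))) (sym (comm _))))

    AB⁻ : ∀ x → A (B⁻ x) ≡ B⁻ (A x)
    AB⁻ x = B-inj (trans (sym (comm _)) (trans (cong A (BB⁻ x)) (sym (BB⁻ _))))

    A⁻B⁻ : ∀ x → A⁻ (B⁻ x) ≡ B⁻ (A⁻ x)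
    A⁻B⁻ x = A-inj (trans (AA⁻ _) (trans (cong B⁻ (sym (AA⁻ x))) (sym (AB⁻ _))))

  module Coordinates (comm : ∀ x → A (B x) ≡ B (A x)) (x₀ : X) (reach : ∀ x → Star Step x₀ x) where
    open Commuting comm

    pt : ℕ → ℕ → X
    pt i j = fold (fold x₀ B j) A i

    B-pt : ∀ i j → B (pt i j) ≡ pt i (suc j)
    B-pt i j = sym (fold-comm A B comm i _)

    opaque
      A-order : ∃ λ p → fold x₀ A (suc p) ≡ x₀ × InjectiveBelow (suc p) (fold x₀ A)
      A-order = order enc A A-inj x₀

      B-order : ∃ λ p → fold x₀ B (suc p) ≡ x₀ × InjectiveBelow (suc p) (fold x₀ B)
      B-order = order enc B B-inj x₀

    Q R : ℕ
    Q = suc (proj₁ A-order)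
    R = suc (proj₁ B-order)

    A^Q₀ : fold x₀ A Q ≡ x₀
    A^Q₀ = proj₁ (proj₂ A-order)
    B^R₀ : fold x₀ B R ≡ x₀
    B^R₀ = proj₁ (proj₂ B-order)

    induction : (P : X → Set) → P x₀ → (∀ {x} → P x → P (A x)) → (∀ {x} → P x → P (A⁻ x)) →
                (∀ {x} → P x → P (B x)) → (∀ {x} → P x → P (B⁻ x)) → ∀ x → P x
    induction P p₀ pA pA⁻ pB pB⁻ x = go (reach x) p₀
      where
      go : ∀ {u v} → Star Step u v → P u → P v
      go ε p = p
      go (fwdA ◅ s) p = go s (pA p)
      go (bwdA ◅ s) p = go s (pA⁻ p)
      go (fwdB ◅ s) p = go s (pB p)
      go (bwdB ◅ s) p = go s (pB⁻ p)

    A^Q : ∀ x → fold x A Q ≡ x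
    A^Q = induction (λ x → fold x A Q ≡ x) A^Q₀
      (λ {x} e → trans (fold-comm A A (λ _ → refl) Q x) (cong A e))
      (λ {x} e → trans (fold-comm A A⁻ (λ x → trans (AA⁻ x) (sym (A⁻A x))) Q x) (cong A⁻ e))
      (λ {x} e → trans (fold-comm A B comm Q x) (cong B e))
      (λ {x} e → trans (fold-comm A B⁻ AB⁻ Q x) (cong B⁻ e))

    B^R : ∀ x → fold x B R ≡ x
    B^R = induction (λ x → fold x B R ≡ x) B^R₀
      (λ {x} e → trans (fold-comm B A (λ x → sym (comm x)) R x) (cong A e))
      (λ {x} e → trans (fold-comm B A⁻ (λ x → sym (A⁻B x)) R x) (cong A⁻ e))
      (λ {x} e → trans (fold-comm B B (λ _ → refl) R x) (cong B e))
      (λ {x} e → trans (fold-comm B B⁻ (λ x → trans (BB⁻ x) (sym (B⁻B x))) R x) (cong B⁻ e))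

    A⁻-power : ∀ x → A⁻ x ≡ fold x A (proj₁ A-order)
    A⁻-power x = A-inj (trans (AA⁻ x) (sym (A^Q x)))

    B⁻-power : ∀ x → B⁻ x ≡ fold x B (proj₁ B-order)
    B⁻-power x = B-inj (trans (BB⁻ x) (sym (B^R x)))

    -- Both permutations have finite order, so their inverses are positive or zero powers and
    -- forward steps generate everything.
    induction⁺ : (P : X → Set) → P x₀ → (∀ {x} → P x → P (A x)) → (∀ {x} → P x → P (B x)) → ∀ x → P x
    induction⁺ P p₀ pA pB = induction P p₀ pA
      (λ {x} p → subst P (sym (A⁻-power x)) (power A pA (proj₁ A-order) p)) pB
      (λ {x} p → subst P (sym (B⁻-power x)) (power B pB (proj₁ B-order) p))
      where
      power : (f : X → X) → (∀ {x} → P x → P (f x)) → ∀ k {x} → P x → P (fold x f k)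
      power f pf zero    p = p
      power f pf (suc k) p = pf (power f pf k p)

    B^[kR] : ∀ k x → fold x B (k * R) ≡ x
    B^[kR] zero    x = refl
    B^[kR] (suc k) x = trans (fold-+ x B R) (trans (B^R _) (B^[kR] k x))

    B^-% : ∀ j x → fold x B j ≡ fold x B (j % R)
    B^-% j x = trans (cong (fold x B) (m≡m%n+[m/n]*n j R))
                 (trans (fold-+ x B (j % R)) (cong (λ z → fold z B (j % R)) (B^[kR] (j / R) x)))

    InRow₀ : X → Set
    InRow₀ x = ∃ λ j → j < R × fold x₀ B j ≡ x

    inRow₀ : ∀ j → InRow₀ (fold x₀ B j)
    inRow₀ j = j % R , m%n<n j R , sym (B^-% j x₀)

    inRow₀-B⁻ : ∀ {x} → InRow₀ (B x) → InRow₀ x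
    inRow₀-B⁻ {x} (j , _ , e) =
      subst InRow₀ (trans (fold-+ x₀ B r) (trans (cong (λ z → fold z B r) e)
        (trans (fold-suc B r x) (B^R x)))) (inRow₀ (r + j))
      where r = proj₁ B-order

    inRow₀-B^ : ∀ k {x} → InRow₀ (fold x B k) → InRow₀ x
    inRow₀-B^ zero    p = p
    inRow₀-B^ (suc k) p = inRow₀-B^ k (inRow₀-B⁻ p)

    opaque
      -- The first positive power of `A` that returns to the `B`-orbit of `x₀`: this exponent `D`
      -- counts the rows, and the place `C` of the return is the twist with which the grid closes
      -- into a torus. The search succeeds because the full period of `A` returns to `x₀`.
      firstD : ∃ λ i → InRow₀ (fold x₀ A (suc i)) × (∀ {k} → k < i → ¬ InRow₀ (fold x₀ A (suc k)))
      firstD = least (λ i → anyUpTo? (λ j → fold x₀ B j ≐ _) R)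
        {n = proj₁ A-order} (0 , z<s , sym A^Q₀)

    d D : ℕ
    d = proj₁ firstD
    D = suc d

    C : ℕ
    C = proj₁ (proj₁ (proj₂ firstD))

    A^D : fold x₀ A D ≡ fold x₀ B C
    A^D = sym (proj₂ (proj₂ (proj₁ (proj₂ firstD))))

    D-least : ∀ {i} → suc i < D → ¬ InRow₀ (fold x₀ A (suc i))
    D-least i<D = proj₂ (proj₂ firstD) (≤-pred i<D)

    D≤ : ∀ i j → fold x₀ A (suc i) ≡ fold x₀ B j → D ≤ suc i
    D≤ i j e = ≮⇒≥ λ i<D → D-least i<D (subst InRow₀ (sym e) (inRow₀ j))

    -- Cancelling `i` applications of `A`, and then the power of `B`, turns a coincidence of two
    -- rows into a return to row 0 earlier than `D`.
    rows-disjoint : ∀ i j i' j' → i < i' → i' < D → pt i j ≢ pt i' j'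
    rows-disjoint i j i' j' i<i' i'<D e
      with i' ∸ suc i | trans (+-suc i (i' ∸ suc i)) (m+[n∸m]≡n i<i')
    ... | o | refl = D-least (≤-<-trans (m≤n+m (suc o) i) i'<D)
      (inRow₀-B^ j' (subst InRow₀
        (trans (fold-injective A A-inj i (trans e (fold-+ (fold x₀ B j') A i))) (fold-comm₂ A B comm (suc o) j' x₀))
        (inRow₀ j)))

    row-injective : ∀ i j i' j' → i < D → i' < D → pt i j ≡ pt i' j' → i ≡ i'
    row-injective i j i' j' i<D i'<D e with <-cmp i i'
    ... | tri≈ _ i≡i' _ = i≡i'
    ... | tri< i<i' _ _ = contradiction e (rows-disjoint i j i' j' i<i' i'<D)
    ... | tri> _ _ i'<i = contradiction (sym e) (rows-disjoint i' j' i j i'<i i<D)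

    pt-injective : ∀ i j i' j' → i < D → i' < D → j < R → j' < R → pt i j ≡ pt i' j' → i ≡ i' × j ≡ j'
    pt-injective i j i' j' i<D i'<D j<R j'<R e with row-injective i j i' j' i<D i'<D e
    ... | refl = refl , injectiveBelow⇒≡ (proj₂ (proj₂ B-order)) j<R j'<R (fold-injective A A-inj i e)

    pt-wrap : ∀ j → pt D j ≡ pt 0 (j + C)
    pt-wrap j = trans (fold-comm₂ A B comm D j x₀) (trans (cong (λ z → fold z B j) A^D) (sym (fold-+ x₀ B j)))

    opaque
      coordinates : ∀ x → ∃₂ λ i j → i < D × j < R × pt i j ≡ x
      coordinates x with induction⁺ (λ x → ∃₂ λ i j → i < D × pt i j ≡ x) (0 , 0 , z<s , refl)
        (λ { (i , j , i<D , refl) → stepA i j i<D }) (λ { (i , j , i<D , refl) → i , suc j , i<D , sym (B-pt i j) }) x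
        where
        stepA : ∀ i j → i < D → ∃₂ λ i' j' → i' < D × pt i' j' ≡ A (pt i j)
        stepA i j i<D with m≤n⇒m<n∨m≡n i<D
        ... | inj₁ 1+i<D = suc i , j , 1+i<D , refl
        ... | inj₂ refl  = 0 , j + C , z<s , sym (pt-wrap j)
      ... | i , j , i<D , e = i , j % R , i<D , m%n<n j R , trans (cong (λ z → fold z A i) (sym (B^-% j x₀))) e

    opaque
      inRow₀-multiple : ∀ k → InRow₀ (fold x₀ A (k * D))
      inRow₀-multiple zero    = inRow₀ 0
      inRow₀-multiple (suc k) with inRow₀-multiple k
      ... | j , _ , e = subst InRow₀ (sym (trans (fold-+ x₀ A D)
            (trans (cong (λ z → fold z A D) (sym e)) (pt-wrap j)))) (inRow₀ (j + C))

    -- Multiples of `D` return to row 0, so a nonzero remainder would be a return before the first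
    -- one.
    D∣ : ∀ {i} → InRow₀ (fold x₀ A i) → D ∣ i
    D∣ {i} p with i % D in eq | m%n<n i D | m≡m%n+[m/n]*n i D
    ... | zero  | _  | i≡ = divides (i / D) i≡
    ... | suc s | lt | i≡ with inRow₀-multiple (i / D)
    ...   | j , _ , e = contradiction (inRow₀-B^ j (subst InRow₀ (trans (cong (fold x₀ A) i≡)
              (trans (fold-+ x₀ A (suc s)) (trans (cong (λ z → fold z A (suc s)) (sym e)) (fold-comm₂ A B comm (suc s) j x₀)))) p))
              (D-least lt)

-- Exchanging the edges of squares

true≢false : true ≢ false
true≢false ()

Adjacent : {X : Set} → (X → X) → (X → X) → X → X → Set
Adjacent o i x y = y ≡ o x ⊎ y ≡ i x

Linked : {X : Set} → (X → X) → X → X → Set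
Linked f = EqClosure λ x y → f x ≡ y

module Flipped {X : Set} (α β : X ↔ X) (S : X → Bool) where
  open Inverse α using () renaming (to to A; from to A⁻)
  open Inverse β using () renaming (to to B; from to B⁻)

  -- `S` holds at the corner `x` of a square `x`, `A x`, `A (B x)`, `B x` whose two `B`-sides are
  -- replaced by its two `A`-sides. `out` stands in for the old neighbour `B x` and `inn` for
  -- `B⁻ x`; in each, the two tests ask whether the lost edge was the lower or the upper `B`-side of
  -- a square.
  out inn : X → X
  out x = if S x then A x else if S (A⁻ x) then A⁻ x else B x
  inn x = if S (B⁻ x) then A x else if S (A⁻ (B⁻ x)) then A⁻ x else B⁻ x

  Edge : X → X → Set
  Edge = Adjacent out inn

module Flip {X : Set} {N : ℕ} (enc : X ↣ Fin N) (α β : X ↔ X)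
            (comm : ∀ x → Inverse.to α (Inverse.to β x) ≡ Inverse.to β (Inverse.to α x))
            (S : X → Bool)
            (S-A : ∀ {x} → S x ≡ true → S (Inverse.to α x) ≡ false) where
  open Torus enc α β
  open Commuting comm

  open Flipped α β S public

  out-A : ∀ {x} → S x ≡ true → out x ≡ A x
  out-A s rewrite s = refl

  -- `S-A` forbids stacking two squares along `A`, so a `B`-edge is never the upper side of one
  -- square and the lower side of another, and the order of the tests in `out` is harmless.
  out-A⁻ : ∀ {x} → S (A⁻ x) ≡ true → out x ≡ A⁻ x
  out-A⁻ {x} s with S x in t
  ... | true  = contradiction (trans (sym t) (trans (cong S (sym (AA⁻ x))) (S-A s))) true≢false
  ... | false rewrite s = refl

  out-B : ∀ {x} → S x ≡ false → S (A⁻ x) ≡ false → out x ≡ B x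
  out-B s t rewrite s | t = refl

  inn-A : ∀ {x} → S (B⁻ x) ≡ true → inn x ≡ A x
  inn-A s rewrite s = refl

  inn-A⁻ : ∀ {x} → S (A⁻ (B⁻ x)) ≡ true → inn x ≡ A⁻ x
  inn-A⁻ {x} s with S (B⁻ x) in t
  ... | true  = contradiction (trans (sym t) (trans (cong S (sym (AA⁻ (B⁻ x)))) (S-A s))) true≢false
  ... | false rewrite s = refl

  inn-B⁻ : ∀ {x} → S (B⁻ x) ≡ false → S (A⁻ (B⁻ x)) ≡ false → inn x ≡ B⁻ x
  inn-B⁻ s t rewrite s | t = refl

  data Rung : X → X → Set where
    up   : ∀ {x} → S x ≡ true ⊎ S (B⁻ x) ≡ true → Rung x (A x)
    down : ∀ {x} → S x ≡ true ⊎ S (B⁻ x) ≡ true → Rung (A x) x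

  -- An untouched edge is `out` at one end and `inn` at the other, but a rung has the same name at
  -- both ends. Hence `out` does not direct the 2-factor consistently, and an orientation has to be
  -- found separately.
  out-view : ∀ x → (Rung x (out x) × out (out x) ≡ x) ⊎ (out x ≡ B x × inn (out x) ≡ x)
  out-view x with S x in s | S (A⁻ x) in t
  ... | true  | _     = inj₁ (up (inj₁ s) , trans (out-A⁻ (trans (cong S (A⁻A x)) s)) (A⁻A x))
  ... | false | true  = inj₁ (subst (λ z → Rung z (A⁻ x)) (AA⁻ x) (down (inj₁ t)) , trans (out-A t) (AA⁻ x))
  ... | false | false = inj₂ (refl , trans (inn-B⁻ (trans (cong S (B⁻B x)) s) (trans (cong (S ∘ A⁻) (B⁻B x)) t)) (B⁻B x))

  inn-view : ∀ x → (Rung x (inn x) × inn (inn x) ≡ x) ⊎ (inn x ≡ B⁻ x × out (inn x) ≡ x)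
  inn-view x with S (B⁻ x) in s | S (A⁻ (B⁻ x)) in t
  ... | true  | _     = inj₁ (up (inj₂ s) , trans (inn-A⁻ (trans (cong S (trans (cong A⁻ (sym (AB⁻ x))) (A⁻A _))) s)) (A⁻A x))
  ... | false | true  = inj₁ (subst (λ z → Rung z (A⁻ x)) (AA⁻ x) (down (inj₂ t')) , trans (inn-A t') (AA⁻ x))
    where t' = trans (cong S (sym (A⁻B⁻ x))) t
  ... | false | false = inj₂ (refl , trans (out-B s t) (BB⁻ x))

  adjacent-sym : ∀ {x y} → Adjacent out inn x y → Adjacent out inn y x
  adjacent-sym {x} (inj₁ refl) with out-view x
  ... | inj₁ (_ , e) = inj₁ (sym e)
  ... | inj₂ (_ , e) = inj₂ (sym e)
  adjacent-sym {x} (inj₂ refl) with inn-view x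
  ... | inj₁ (_ , e) = inj₂ (sym e)
  ... | inj₂ (_ , e) = inj₁ (sym e)

  -- If c is constant on the B-orbits and changes along every rung, the 2-factor is
  -- oriented by following the B-orbits forwards where c is true and backwards where it is false.
  module Orientation (c : X → Bool) (c-B : ∀ x → c (B x) ≡ c x)
                     (c-A : ∀ {x} → S x ≡ true → c (A x) ≡ not (c x)) where

    c-B⁻ : ∀ x → c (B⁻ x) ≡ c x
    c-B⁻ x = trans (sym (c-B (B⁻ x))) (cong c (BB⁻ x))

    c-up : ∀ {x} → S x ≡ true ⊎ S (B⁻ x) ≡ true → c (A x) ≡ not (c x)
    c-up     (inj₁ s) = c-A s
    c-up {x} (inj₂ s) = trans (sym (c-B⁻ (A x))) (trans (cong c (sym (AB⁻ x))) (trans (c-A s) (cong not (c-B⁻ x))))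

    c-rung : ∀ {x y} → Rung x y → c y ≡ not (c x)
    c-rung (up s)       = c-up s
    c-rung (down {x} s) = trans (sym (not-involutive _)) (cong not (sym (c-up s)))

    f f⁻ : X → X
    f  x = if c x then out x else inn x
    f⁻ x = if c x then inn x else out x

    f⁻f : ∀ x → f⁻ (f x) ≡ x
    f⁻f x with c x in cx
    ... | true with out-view x
    ...   | inj₁ (r , e) rewrite trans (c-rung r) (cong not cx) = e
    ...   | inj₂ (b , e) rewrite trans (cong c b) (trans (c-B x) cx) = e
    f⁻f x | false with inn-view x
    ...   | inj₁ (r , e) rewrite trans (c-rung r) (cong not cx) = e
    ...   | inj₂ (b , e) rewrite trans (cong c b) (trans (c-B⁻ x) cx) = e

    ff⁻ : ∀ x → f (f⁻ x) ≡ x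
    ff⁻ x with c x in cx
    ... | false with out-view x
    ...   | inj₁ (r , e) rewrite trans (c-rung r) (cong not cx) = e
    ...   | inj₂ (b , e) rewrite trans (cong c b) (trans (c-B x) cx) = e
    ff⁻ x | true with inn-view x
    ...   | inj₁ (r , e) rewrite trans (c-rung r) (cong not cx) = e
    ...   | inj₂ (b , e) rewrite trans (cong c b) (trans (c-B⁻ x) cx) = e

    oriented : X ↔ X
    oriented = mk↔ₛ′ f f⁻ ff⁻ f⁻f

    oriented-sum : (φ : X → ℕ) → ∀ x → φ (f x) + φ (f⁻ x) ≡ φ (out x) + φ (inn x)
    oriented-sum φ x with c x
    ... | true  = refl
    ... | false = +-comm (φ (inn x)) (φ (out x))

module _ {X : Set} {N : ℕ} (enc : X ↣ Fin N) (α β : X ↔ X)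
         (comm : ∀ x → Inverse.to α (Inverse.to β x) ≡ Inverse.to β (Inverse.to α x))
         (S : X → Bool)
         (S-A : ∀ {x} → S x ≡ true → S (Inverse.to α x) ≡ false)
         (S-B : ∀ {x} → S x ≡ true → S (Inverse.to β x) ≡ false) where
  open Torus enc α β
  open Commuting comm
  private
    module H = Flip enc α β comm S S-A
    module V = Flip enc β α (λ x → sym (comm x)) S S-B

  -- A side that leaves one factor enters the other. The cases say which of the four squares around
  -- `x` are chosen: two sharing a side contradict `S-A` or `S-B`, while two opposite ones may occur
  -- together.
  flip-sum : (φ : X → ℕ) → ∀ x →
    (φ (H.out x) + φ (H.inn x)) + (φ (V.out x) + φ (V.inn x)) ≡ (φ (A x) + φ (A⁻ x)) + (φ (B x) + φ (B⁻ x))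
  flip-sum φ x rewrite sym (A⁻B⁻ x) with S x in s₁ | S (A⁻ x) in s₂ | S (B⁻ x) in s₃ | S (A⁻ (B⁻ x)) in s₄
  ... | true  | true  | _     | _     = contradiction (trans (sym s₁) (trans (cong S (sym (AA⁻ x))) (S-A s₂))) true≢false
  ... | true  | false | true  | _     = contradiction (trans (sym s₁) (trans (cong S (sym (BB⁻ x))) (S-B s₃))) true≢false
  ... | true  | false | false | true  = refl
  ... | true  | false | false | false = solve₁ (φ (A x)) (φ (B⁻ x)) (φ (B x)) (φ (A⁻ x))
    where solve₁ : ∀ a b c d → (a + b) + (c + d) ≡ (a + d) + (c + b)
          solve₁ = solve-∀
  ... | false | true  | _     | true  = contradiction (trans (sym s₂) (trans (cong S (sym
          (trans (cong B (A⁻B⁻ x)) (BB⁻ _)))) (S-B s₄))) true≢false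
  ... | false | true  | true  | false = solve₂ (φ (A⁻ x)) (φ (A x)) (φ (B⁻ x)) (φ (B x))
    where solve₂ : ∀ a b c d → (a + b) + (c + d) ≡ (b + a) + (d + c)
          solve₂ = solve-∀
  ... | false | true  | false | false = solve₃ (φ (A⁻ x)) (φ (B⁻ x)) (φ (A x)) (φ (B x))
    where solve₃ : ∀ a b c d → (a + b) + (c + d) ≡ (c + a) + (d + b)
          solve₃ = solve-∀
  ... | false | false | true  | true  = contradiction (trans (sym s₃) (trans (cong S (sym (AA⁻ _))) (S-A s₄))) true≢false
  ... | false | false | true  | false = solve₄ (φ (B x)) (φ (A x)) (φ (B⁻ x)) (φ (A⁻ x))
    where solve₄ : ∀ a b c d → (a + b) + (c + d) ≡ (b + d) + (a + c)
          solve₄ = solve-∀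
  ... | false | false | false | true  = solve₅ (φ (B x)) (φ (A⁻ x)) (φ (A x)) (φ (B⁻ x))
    where solve₅ : ∀ a b c d → (a + b) + (c + d) ≡ (c + b) + (a + d)
          solve₅ = solve-∀
  ... | false | false | false | false = +-comm (φ (B x) + φ (B⁻ x)) _

-- Walking around a connected graph in which every vertex has two neighbours

module Walk {X : Set} {N : ℕ} (enc : X ↣ Fin N) (o i : X → X)
            (E-sym : ∀ {x y} → Adjacent o i x y → Adjacent o i y x)
            (o≢i : ∀ x → o x ≢ i x) (o≢x : ∀ x → o x ≢ x) (i≢x : ∀ x → i x ≢ x)
            (x₀ : X) (connected : ∀ x → EqClosure (Adjacent o i) x₀ x) where

  private
    _≐_ = via-injection enc Fin._≟_
    E = Adjacent o i

  other : X → X → X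
  other v u with u ≐ o v
  ... | yes _ = i v
  ... | no _  = o v

  E-other : ∀ v u → E v (other v u)
  E-other v u with u ≐ o v
  ... | yes _ = inj₂ refl
  ... | no _  = inj₁ refl

  other≢ : ∀ {v u} → E v u → other v u ≢ u
  other≢ {v} {u} e with u ≐ o v
  ... | yes refl = λ eq → o≢i v (sym eq)
  other≢ (inj₁ u≡o) | no u≢o = contradiction u≡o u≢o
  other≢ (inj₂ refl) | no u≢o = o≢i _

  only-two : ∀ {v u z} → E v u → E v z → z ≡ u ⊎ z ≡ other v u
  only-two {v} {u} e e' with u ≐ o v
  only-two e (inj₁ z≡o) | yes u≡o = inj₁ (trans z≡o (sym u≡o))
  only-two e (inj₂ z≡i) | yes u≡o = inj₂ z≡i
  only-two e (inj₁ z≡o) | no u≢o  = inj₂ z≡o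
  only-two (inj₁ u≡o) (inj₂ z≡i) | no u≢o = contradiction u≡o u≢o
  only-two (inj₂ u≡i) (inj₂ z≡i) | no u≢o = inj₁ (trans z≡i (sym u≡i))

  walk : ℕ → X × X
  walk zero    = x₀ , o x₀
  walk (suc k) = proj₂ (walk k) , other (proj₂ (walk k)) (proj₁ (walk k))

  w : ℕ → X
  w k = proj₁ (walk k)

  w-E : ∀ k → E (w k) (w (suc k))
  w-E zero    = inj₁ refl
  w-E (suc k) = E-other (w (suc k)) (w k)

  w-turn : ∀ k → w (suc (suc k)) ≢ w k
  w-turn k = other≢ (E-sym (w-E k))

  no-loop : ∀ {x} → ¬ E x x
  no-loop {x} (inj₁ e) = o≢x x (sym e)
  no-loop {x} (inj₂ e) = i≢x x (sym e)

  -- Suppose the first repeated vertex were an inner one, `w (suc k)`. Both its neighbours `w k` and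
  -- `w (suc (suc k))` already belong to the walk, so arriving there again means an earlier
  -- repetition, a reversal of direction or a loop.
  closed-walk : ∃ λ p → w (suc p) ≡ x₀ × InjectiveBelow (suc p) w
  closed-walk = from (first-repeat enc w)
    where
    from : (∃ λ j → (∃ λ i → i < j × w i ≡ w j) × InjectiveBelow j w) →
           ∃ λ p → w (suc p) ≡ x₀ × InjectiveBelow (suc p) w
    from (suc p , (zero , _ , eq) , below) = p , sym eq , below
    from (suc p , (suc k , s≤s k<p , eq) , below)
      with only-two (E-sym (w-E k)) (subst (λ z → E z (w p)) (sym eq) (E-sym (w-E p)))
    ... | inj₁ wp≡wk = contradiction (sym wp≡wk) (below k<p (n<1+n p))
    ... | inj₂ wp≡wk+2 with <-cmp p (suc (suc k))
    ...   | tri≈ _ refl _ = contradiction (sym eq) (w-turn (suc k))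
    ...   | tri> _ _ k+2<p = contradiction (sym wp≡wk+2) (below k+2<p (n<1+n p))
    ...   | tri< p<k+2 _ _ with ≤-antisym (≤-pred p<k+2) k<p
    ...     | refl = ⊥-elim (no-loop (subst (E (w (suc k))) (sym wp≡wk+2) (w-E (suc k))))

  module Closed (p : ℕ) (closes : w (suc p) ≡ x₀) (below : InjectiveBelow (suc p) w) where

    last-E : E x₀ (w p)
    last-E = subst (λ z → E z (w p)) closes (E-sym (w-E p))

    -- This rules out closed walks on one or two vertices, and so keeps successor and predecessor
    -- apart at the starting point, where `w-turn` does not apply.
    last≢first : w 1 ≢ w p
    last≢first = apart p closes below
      where
      apart : ∀ q → w (suc q) ≡ x₀ → InjectiveBelow (suc q) w → w 1 ≢ w q
      apart zero          closes below e = no-loop (subst (E x₀) e (w-E 0))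
      apart (suc zero)    closes below e = w-turn 0 closes
      apart (suc (suc q)) closes below e = below (s≤s z<s) (n<1+n _) e

    0<p : 0 < p
    0<p = n≢0⇒n>0 λ p≡0 → no-loop (subst (E x₀) (trans (cong (w ∘ suc) (sym p≡0)) closes) (w-E 0))

    Visited : X → Set
    Visited x = ∃ λ k → k < suc p × w k ≡ x

    visited-E : ∀ {x y} → E x y → Visited x → Visited y
    visited-E {y = y} e (zero , _ , refl) with only-two last-E e
    ... | inj₁ y≡wp = p , n<1+n p , sym y≡wp
    ... | inj₂ y≡other with only-two last-E (w-E 0)
    ...   | inj₁ w1≡wp = contradiction w1≡wp last≢first
    ...   | inj₂ w1≡other = 1 , s≤s 0<p , trans w1≡other (sym y≡other)
    visited-E e (suc k , s≤s k<p , refl) with only-two (E-sym (w-E k)) e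
    ... | inj₁ y≡wk = k , m≤n⇒m≤1+n k<p , sym y≡wk
    ... | inj₂ y≡ with m≤n⇒m<n∨m≡n k<p
    ...   | inj₁ k+1<p = suc (suc k) , s≤s k+1<p , sym y≡
    ...   | inj₂ refl  = 0 , z<s , trans (sym closes) (sym y≡)

    visited : ∀ x → Visited x
    visited x = go (connected x) (0 , z<s , refl)
      where
      go : ∀ {u v} → EqClosure E u v → Visited u → Visited v
      go ε v = v
      go (fwd e ◅ s) v = go s (visited-E e v)
      go (bwd e ◅ s) v = go s (visited-E (E-sym e) v)

    index : X → ℕ
    index x = proj₁ (visited x)

    w-index : ∀ x → w (index x) ≡ x
    w-index x = proj₂ (proj₂ (visited x))

    index-w : ∀ {k} → k < suc p → index (w k) ≡ k
    index-w {k} k<p = injectiveBelow⇒≡ below (proj₁ (proj₂ (visited (w k)))) k<p (w-index (w k))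

    before : ℕ → ℕ
    before zero    = p
    before (suc k) = k

    w-before : ∀ k → k < suc p → w (suc (before k)) ≡ w k
    w-before zero    _ = closes
    w-before (suc k) _ = refl

    before-< : ∀ k → k < suc p → before k < suc p
    before-< zero    _ = n<1+n p
    before-< (suc k) k<p = <-trans (n<1+n k) k<p

    f f⁻ : X → X
    f  x = w (suc (index x))
    f⁻ x = w (before (index x))

    ff⁻ : ∀ x → f (f⁻ x) ≡ x
    ff⁻ x with visited x
    ... | k , k<p , wk≡x = trans (cong (w ∘ suc) (index-w (before-< k k<p))) (trans (w-before k k<p) wk≡x)

    f⁻f : ∀ x → f⁻ (f x) ≡ x
    f⁻f x with visited x
    ... | k , s≤s k≤p , wk≡x with m≤n⇒m<n∨m≡n k≤p
    ...   | inj₁ k<p  = trans (cong (w ∘ before) (index-w (s≤s k<p))) wk≡x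
    ...   | inj₂ refl = trans (cong (w ∘ before ∘ index) closes) (trans (cong (w ∘ before) (index-w z<s)) wk≡x)

    f≢f⁻ : ∀ x → f x ≢ f⁻ x
    f≢f⁻ x e with visited x
    ... | zero  , _ = last≢first e
    ... | suc k , _ = w-turn k e

    E-f : ∀ x → E x (f x)
    E-f x = subst (λ z → E z (f x)) (w-index x) (w-E (index x))

    E-f⁻ : ∀ x → E x (f⁻ x)
    E-f⁻ x = E-sym (subst (E (f⁻ x)) (ff⁻ x) (E-f (f⁻ x)))

    oriented-sum : (φ : X → ℕ) → ∀ x → φ (f x) + φ (f⁻ x) ≡ φ (o x) + φ (i x)
    oriented-sum φ x with E-f x | E-f⁻ x
    ... | inj₁ e | inj₁ e' = contradiction (trans e (sym e')) (f≢f⁻ x)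
    ... | inj₁ e | inj₂ e' = cong₂ _+_ (cong φ e) (cong φ e')
    ... | inj₂ e | inj₁ e' = trans (+-comm (φ (f x)) _) (cong₂ _+_ (cong φ e') (cong φ e))
    ... | inj₂ e | inj₂ e' = contradiction (trans e (sym e')) (f≢f⁻ x)

    E⇒linked : ∀ {x y} → E x y → Linked f x y
    E⇒linked {x} {y} e with only-two (E-f x) e
    ... | inj₁ y≡fx = EqC.return (sym y≡fx)
    ... | inj₂ y≡   with only-two (E-f x) (E-f⁻ x)
    ...   | inj₁ f⁻≡f = contradiction (sym f⁻≡f) (f≢f⁻ x)
    ...   | inj₂ f⁻≡  = EqC.symmetric _ (EqC.return (trans (cong f (trans y≡ (sym f⁻≡))) (ff⁻ x)))

  -- Being connected, the graph is a single cycle, and the walk around it supplies the direction.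
  -- For factors with several cycles the direction comes instead from a two-colouring, as in
  -- `Flip.Orientation`.
  orientation : Σ (X ↔ X) λ f →
      (∀ (φ : X → ℕ) x → φ (Inverse.to f x) + φ (Inverse.from f x) ≡ φ (o x) + φ (i x))
    × (∀ x → Linked (Inverse.to f) x₀ x)
  orientation with closed-walk
  ... | p , closes , below = mk↔ₛ′ f f⁻ ff⁻ f⁻f , oriented-sum , λ x → (E⇒linked EqC.⋆) (connected x)
    where open Closed p closes below

-- Connectivity of cycles that have been cut

module _ {X : Set} {E : X → X → Set} where

  reversed : ∀ {x y} → EqClosure E x y → EqClosure E y x
  reversed = EqC.symmetric E

  ≡⇒linked : ∀ {x y} → x ≡ y → EqClosure E x y
  ≡⇒linked refl = ε

  chain : ∀ (w : ℕ → X) {a b} → (∀ {k} → a ≤ k → k < b → EqClosure E (w k) (w (suc k))) →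
          ∀ {k} → a ≤ k → k ≤ b → EqClosure E (w a) (w k)
  chain w {a} step {zero}  a≤k k≤b = ≡⇒linked (cong w (n≤0⇒n≡0 a≤k))
  chain w {a} step {suc k} a≤k k≤b with m≤n⇒m<n∨m≡n a≤k
  ... | inj₁ (s≤s a≤k') = chain w step a≤k' (<⇒≤ k≤b) ◅◅ step a≤k' k≤b
  ... | inj₂ refl       = ε

  -- A cycle without one edge is still a path: positions beyond the cut are reached backwards from
  -- the end, which coincides with the start.
  cut-cycle : ∀ (w : ℕ → X) {per z} → w per ≡ w 0 → z < per →
              (∀ {i} → i < per → i ≢ z → EqClosure E (w i) (w (suc i))) →
              ∀ {i} → i ≤ per → EqClosure E (w 0) (w i)
  cut-cycle w {per} {z} wrap z<per step {i} i≤per with i ≤? z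
  ... | yes i≤z = chain w (λ _ k<i → step (<-≤-trans k<i i≤per) (<⇒≢ (<-≤-trans k<i i≤z))) z≤n ≤-refl
  ... | no  i≰z = ≡⇒linked (sym wrap) ◅◅ reversed (chain w (λ i≤k k<per → step k<per (>⇒≢ (<-≤-trans (≰⇒> i≰z) i≤k))) i≤per ≤-refl)

  -- Consecutive cycles are cut at one position and joined there by two rungs, so the
  -- ends of a cut remain linked through the later cycles.
  module Ladder (c : ℕ → ℕ → X) (per top : ℕ) (z : ℕ → ℕ)
    (wrap : ∀ j → c j per ≡ c j 0) (z< : ∀ {j} → j < top → z j < per)
    (edge : ∀ {j i} → j < top → i < per → (suc j < top → i ≢ z (suc j)) → i ≢ z j →
            EqClosure E (c (suc j) i) (c (suc j) (suc i)))
    (rung  : ∀ {j} → j < top → EqClosure E (c j (z j)) (c (suc j) (z j)))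
    (rung′ : ∀ {j} → j < top → EqClosure E (c j (suc (z j))) (c (suc j) (suc (z j)))) where

    private
      across : ∀ {j} → j < top → (∀ {i} → i ≤ per → EqClosure E (c (suc j) 0) (c (suc j) i)) →
               EqClosure E (c j (z j)) (c j (suc (z j)))
      across j< conn = rung j< ◅◅ reversed (conn (<⇒≤ (z< j<))) ◅◅ conn (z< j<) ◅◅ reversed (rung′ j<)

      -- Downward induction from the last cycle, which has a single cut. Any other cycle has two
      -- cuts; the one towards the next cycle is bridged by induction, and `cut-cycle` tolerates the
      -- other.
      from-top : ∀ t {j} → suc j + t ≡ top → ∀ {i} → i ≤ per → EqClosure E (c (suc j) 0) (c (suc j) i)
      from-top zero {j} eq = cut-cycle (c (suc j)) (wrap (suc j)) (z< j<)
          λ i< i≢ → edge j< i< (λ j+1< → contradiction (trans (sym (+-identityʳ _)) eq) (<⇒≢ j+1<)) i≢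
        where j< = subst (j <_) eq (s≤s (m≤m+n j 0))
      from-top (suc t) {j} eq = cut-cycle (c (suc j)) (wrap (suc j)) (z< j<) step
        where
        j< = subst (j <_) eq (s≤s (m≤m+n j (suc t)))
        j+1< = subst (suc j <_) eq (s≤s (m<m+n j z<s))
        step : ∀ {i} → i < per → i ≢ z j → EqClosure E (c (suc j) i) (c (suc j) (suc i))
        step {i} i< i≢ with i Data.Nat.≟ z (suc j)
        ... | yes refl = across j+1< (from-top t (trans (sym (+-suc (suc j) t)) eq))
        ... | no  i≢′  = edge j< i< (λ _ → i≢′) i≢

    cycle-linked : ∀ {j} → j < top → ∀ {i} → i ≤ per → EqClosure E (c (suc j) 0) (c (suc j) i)
    cycle-linked {j} j< = from-top (top ∸ suc j) (m+[n∸m]≡n j<)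

    cut-linked : ∀ {j} → j < top → EqClosure E (c j (z j)) (c j (suc (z j)))
    cut-linked j< = across j< (cycle-linked j<)

-- Squares between consecutive rows and the two factors they produce

module Squares {X : Set} {N : ℕ} (enc : X ↣ Fin N) (α β : X ↔ X)
               (comm : ∀ x → Inverse.to α (Inverse.to β x) ≡ Inverse.to β (Inverse.to α x))
               (x₀ : X) (reach : ∀ x → Star (Torus.Step enc α β) x₀ x) where
  open Torus enc α β public
  open Coordinates comm x₀ reach public

  -- A set S of squares such that exchanging their edges turns the orbits of B into one
  -- Hamilton cycle and the orbits of A into another.
  record HamiltonianFlip : Set where
    field
      S        : X → Bool
      S-A      : ∀ {x} → S x ≡ true → S (A x) ≡ false
      S-B      : ∀ {x} → S x ≡ true → S (B x) ≡ false
      H-linked : ∀ x → EqClosure (Flipped.Edge α β S) x₀ x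
      V-linked : ∀ x → EqClosure (Flipped.Edge β α S) x₀ x

  -- One square joins rows `h` and `suc h` for each `h < d`, and none joins the last row to the
  -- first, so the rows form a ladder and not a ring. `y<` keeps squares off the seam of the
  -- coordinates, and `y≢` prevents stacking.
  module Factors (y : ℕ → ℕ) (y< : ∀ {h} → h < d → suc (y h) < R)
                 (y≢ : ∀ {h} → suc h < d → y h ≢ y (suc h)) where

    Corner : X → Set
    Corner x = ∃ λ h → h < d × x ≡ pt h (y h)

    opaque
      S : X → Bool
      S x = does (anyUpTo? (λ h → x ≐ pt h (y h)) d)

      S-true : ∀ {x} → S x ≡ true → Corner x
      S-true {x} s with anyUpTo? (λ h → x ≐ pt h (y h)) d
      ... | yes c = c

      corner⇒S : ∀ {x} → Corner x → S x ≡ true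
      corner⇒S c = dec-true (anyUpTo? _ d) c

      ¬corner⇒¬S : ∀ {x} → ¬ Corner x → S x ≡ false
      ¬corner⇒¬S c = dec-false (anyUpTo? _ d) c

    h<D : ∀ {h} → h < d → h < D
    h<D = m<n⇒m<1+n

    y<R : ∀ {h} → h < d → y h < R
    y<R h<d = <-trans (n<1+n _) (y< h<d)

    S-A : ∀ {x} → S x ≡ true → S (A x) ≡ false
    S-A s with S-true s
    ... | h , h<d , refl = ¬corner⇒¬S λ { (h' , h'<d , e) → clash h' h'<d e }
      where
      clash : ∀ h' → h' < d → pt (suc h) (y h) ≢ pt h' (y h')
      clash h' h'<d e with pt-injective (suc h) (y h) h' (y h') (s≤s h<d) (h<D h'<d) (y<R h<d) (y<R h'<d) e
      ... | refl , e' = y≢ h'<d e'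

    S-B : ∀ {x} → S x ≡ true → S (B x) ≡ false
    S-B s with S-true s
    ... | h , h<d , refl = ¬corner⇒¬S λ { (h' , h'<d , e) → clash h' h'<d (trans (sym (B-pt h (y h))) e) }
      where
      clash : ∀ h' → h' < d → pt h (suc (y h)) ≢ pt h' (y h')
      clash h' h'<d e with pt-injective h (suc (y h)) h' (y h') (h<D h<d) (h<D h'<d) (y< h<d) (y<R h'<d) e
      ... | refl , e' = 1+n≢n e'

    module H = Flip enc α β comm S S-A
    module V = Flip enc β α (λ x → sym (comm x)) S S-B

    _~H_ _~V_ : X → X → Set
    _~H_ = EqClosure (Flipped.Edge α β S)
    _~V_ = EqClosure (Flipped.Edge β α S)

    S-A⁻ : ∀ {x} → S (A⁻ x) ≡ true → ∃ λ h → h < d × x ≡ pt (suc h) (y h)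
    S-A⁻ {x} s with S-true s
    ... | h , h<d , e = h , h<d , trans (sym (AA⁻ x)) (cong A e)

    S-B⁻ : ∀ {x} → S (B⁻ x) ≡ true → ∃ λ h → h < d × x ≡ pt h (suc (y h))
    S-B⁻ {x} s with S-true s
    ... | h , h<d , e = h , h<d , trans (sym (BB⁻ x)) (trans (cong B e) (B-pt h (y h)))

    S-corner : ∀ {h} → h < d → S (pt h (y h)) ≡ true
    S-corner {h} h<d = corner⇒S (h , h<d , refl)

    S-below : ∀ {h} → h < d → S (A⁻ (pt (suc h) (y h))) ≡ true
    S-below h<d = trans (cong S (A⁻A _)) (S-corner h<d)

    S-left : ∀ {h} → h < d → S (B⁻ (pt h (suc (y h)))) ≡ true
    S-left {h} h<d = trans (cong (S ∘ B⁻) (sym (B-pt h (y h)))) (trans (cong S (B⁻B _)) (S-corner h<d))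

    H-edge : ∀ {h j} → h < D → j < R → (h < d → j ≢ y h) → (∀ {h'} → h ≡ suc h' → j ≢ y h') → pt h j ~H pt h (suc j)
    H-edge {h} {j} h<D' j<R j≢ j≢′ = EqC.return (inj₁ (sym (trans (H.out-B s s′) (B-pt h j))))
      where
      s : S (pt h j) ≡ false
      s = ¬corner⇒¬S λ { (h' , h'<d , e) → case h' h'<d (pt-injective h j h' (y h') h<D' (h<D h'<d) j<R (y<R h'<d) e) }
        where case : ∀ h' → h' < d → h ≡ h' × j ≡ y h' → ⊥
              case _ h<d (refl , e) = j≢ h<d e
      s′ : S (A⁻ (pt h j)) ≡ false
      s′ = ¬-not λ t → case (S-A⁻ t)
        where case : (∃ λ h' → h' < d × pt h j ≡ pt (suc h') (y h')) → ⊥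
              case (h' , h'<d , e) with pt-injective h j (suc h') (y h') h<D' (s≤s h'<d) j<R (y<R h'<d) e
              ... | refl , e' = j≢′ refl e'

    H-rung : ∀ {h} → h < d → pt h (y h) ~H pt (suc h) (y h)
    H-rung h<d = EqC.return (inj₁ (sym (H.out-A (S-corner h<d))))

    H-rung′ : ∀ {h} → h < d → pt h (suc (y h)) ~H pt (suc h) (suc (y h))
    H-rung′ h<d = EqC.return (inj₂ (sym (H.inn-A (S-left h<d))))

    pt-R : ∀ h → pt h R ≡ pt h 0
    pt-R h = cong (λ x → fold x A h) B^R₀

    private
      H-edge⁺ : ∀ {h j} → h < d → j < R → (suc h < d → j ≢ y (suc h)) → j ≢ y h → pt (suc h) j ~H pt (suc h) (suc j)
      H-edge⁺ h<d j<R j≢ j≢′ = H-edge (s≤s h<d) j<R j≢ λ { refl → j≢′ }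

      module HL = Ladder pt R d y pt-R y<R H-edge⁺ H-rung H-rung′

      row₀-linked : ∀ {j} → j < R → pt 0 j ~H pt 0 (suc j)
      row₀-linked {j} j<R with 0 <? d | j Data.Nat.≟ y 0
      ... | yes 0<d | yes refl = HL.cut-linked 0<d
      ... | yes 0<d | no j≢    = H-edge z<s j<R (λ _ → j≢) λ ()
      ... | no ¬0<d | _        = H-edge z<s j<R (λ 0<d → contradiction 0<d ¬0<d) λ ()

      row-linked : ∀ {h} → h < D → ∀ {j} → j ≤ R → pt h 0 ~H pt h j
      row-linked {zero}  h<D     = chain (pt 0) (λ _ → row₀-linked) z≤n
      row-linked {suc h} (s≤s h<d) = HL.cycle-linked h<d

      next-row : ∀ {h} → suc h < D → pt h 0 ~H pt (suc h) 0
      next-row {h} (s≤s h<d) =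
        row-linked (h<D h<d) (<⇒≤ (y<R h<d)) ◅◅ H-rung h<d ◅◅ reversed (row-linked (s≤s h<d) (<⇒≤ (y<R h<d)))

    H-linked : ∀ x → x₀ ~H x
    H-linked x with coordinates x
    ... | h , j , h<D , j<R , refl =
      chain (λ i → pt i 0) (λ _ k<h → next-row (<-≤-trans (s≤s k<h) h<D)) z≤n ≤-refl ◅◅ row-linked h<D (<⇒≤ j<R)

    -- Columns continue above height `d`, where `pt-injective` no longer separates points. The
    -- conditions are therefore left as inequalities of points, to be settled in whichever chart
    -- fits.
    rise : ∀ i j → (∀ {h} → h < d → pt i j ≢ pt h (y h)) → (∀ {h} → h < d → pt i j ≢ pt h (suc (y h))) →
           pt i j ~V pt (suc i) j
    rise i j ≢y ≢1+y = EqC.return (inj₁ (sym (V.out-B s s′)))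
      where
      s = ¬corner⇒¬S λ { (h , h<d , e) → ≢y h<d e }
      s′ : S (B⁻ (pt i j)) ≡ false
      s′ = ¬-not λ t → case (S-B⁻ t)
        where case : (∃ λ h → h < d × pt i j ≡ pt h (suc (y h))) → ⊥
              case (h , h<d , e) = ≢1+y h<d e

    V-bottom : ∀ {h} → h < d → pt h (y h) ~V pt h (suc (y h))
    V-bottom {h} h<d = EqC.return (inj₁ (sym (trans (V.out-A (S-corner h<d)) (B-pt h (y h)))))

    V-top : ∀ {h} → h < d → pt (suc h) (y h) ~V pt (suc h) (suc (y h))
    V-top {h} h<d = EqC.return (inj₂ (sym (trans (V.inn-A (S-below h<d)) (B-pt (suc h) (y h)))))

    rise-inside : ∀ {h j} → h < d → j < R → j ≢ y h → j ≢ suc (y h) → pt h j ~V pt (suc h) j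
    rise-inside {h} {j} h<d j<R j≢ j≢′ = rise h j
        (λ {h'} h'<d e → case h' (pt-injective h j h' (y h') (h<D h<d) (h<D h'<d) j<R (y<R h'<d) e))
        (λ {h'} h'<d e → case′ h' (pt-injective h j h' (suc (y h')) (h<D h<d) (h<D h'<d) j<R (y< h'<d) e))
      where
      case : ∀ h' → h ≡ h' × j ≡ y h' → ⊥
      case _ (refl , e) = j≢ e
      case′ : ∀ h' → h ≡ h' × j ≡ suc (y h') → ⊥
      case′ _ (refl , e) = j≢′ e

    -- While the squares alternate between the lines 0-1 and 1-2, each height leaves exactly
    -- one of the lines 0 and 2 uncut.
    module Zigzag (K : ℕ) (K≤d : K ≤ d) (2<R : 2 < R) (y01 : ∀ {h} → h < K → y h ≡ 0 ⊎ y h ≡ 1) where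

      free : ℕ → ℕ
      free zero    = 2
      free (suc _) = 0

      private
        h<d′ : ∀ {h} → h < K → h < d
        h<d′ h<K = <-≤-trans h<K K≤d

      rise-free : ∀ {h} → h < K → pt h (free (y h)) ~V pt (suc h) (free (y h))
      rise-free {h} h<K = rise-inside (h<d′ h<K) (free< (y h)) (free≢ (y h)) (free≢1+ (y h) (y01 h<K))
        where
        free< : ∀ k → free k < R
        free< zero    = 2<R
        free< (suc k) = z<s
        free≢ : ∀ k → free k ≢ k
        free≢ zero    ()
        free≢ (suc k) ()
        free≢1+ : ∀ k → k ≡ 0 ⊎ k ≡ 1 → free k ≢ suc k
        free≢1+ zero    _ ()
        free≢1+ (suc k) _ ()

      three : ∀ h → pt h 1 ~V pt h 0 → pt h 1 ~V pt h 2 → ∀ {j} → j ≤ 2 → pt h 1 ~V pt h j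
      three h l r {0} _ = l
      three h l r {1} _ = ε
      three h l r {2} _ = r
      three h l r {suc (suc (suc _))} (s≤s (s≤s ()))

      inside : ∀ {h} → suc h < K → ∀ {j} → j ≤ 2 → pt (suc h) 1 ~V pt (suc h) j
      inside {h} h<K with y01 (<-trans (n<1+n h) h<K) | y01 h<K | V-top (h<d′ (<-trans (n<1+n h) h<K)) | V-bottom (h<d′ h<K)
      ... | inj₁ e | inj₁ e' | _ | _ = contradiction (trans e (sym e')) (y≢ (h<d′ h<K))
      ... | inj₂ e | inj₂ e' | _ | _ = contradiction (trans e (sym e')) (y≢ (h<d′ h<K))
      ... | inj₁ e | inj₂ e' | t | b rewrite e | e' = three (suc h) (reversed t) b
      ... | inj₂ e | inj₁ e' | t | b rewrite e | e' = three (suc h) (reversed b) t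

      free≤2 : ∀ k → free k ≤ 2
      free≤2 zero    = ≤-refl
      free≤2 (suc k) = z≤n

      -- This is the long strand of the zigzag: it enters on the line avoided by the first square,
      -- sweeps all inner rows, and leaves on the line avoided by the last. The other two lower ends
      -- are tied by the first square, the other two upper ends by the last.
      through : ∀ {h} → h < K → pt 0 (free (y 0)) ~V pt (suc h) (free (y h))
      through {zero}  h<K = rise-free h<K
      through {suc h} h<K = through (<-trans (n<1+n h) h<K) ◅◅ reversed (inside h<K (free≤2 (y h)))
                            ◅◅ inside h<K (free≤2 (y (suc h))) ◅◅ rise-free h<K

      interior : ∀ {h} → suc h < K → ∀ {j} → j ≤ 2 → pt 0 (free (y 0)) ~V pt (suc h) j
      interior {h} h<K j≤2 = through (<-trans (n<1+n h) h<K) ◅◅ reversed (inside h<K (free≤2 (y h))) ◅◅ inside h<K j≤2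

-- Placing the squares

alt : ℕ → ℕ
alt zero          = 0
alt (suc zero)    = 1
alt (suc (suc h)) = alt h

alt-01 : ∀ h → alt h ≡ 0 ⊎ alt h ≡ 1
alt-01 zero          = inj₁ refl
alt-01 (suc zero)    = inj₂ refl
alt-01 (suc (suc h)) = alt-01 h

alt-≢ : ∀ h → alt h ≢ alt (suc h)
alt-≢ zero          ()
alt-≢ (suc zero)    ()
alt-≢ (suc (suc h)) = alt-≢ h

alt-even : ∀ t → alt (t * 2) ≡ 0
alt-even zero    = refl
alt-even (suc t) = alt-even t

alt-odd : ∀ t → alt (suc (t * 2)) ≡ 1
alt-odd zero    = refl
alt-odd (suc t) = alt-odd t

alt≤1 : ∀ h → alt h ≤ 1
alt≤1 h with alt-01 h
... | inj₁ e rewrite e = z≤n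
... | inj₂ e rewrite e = ≤-refl

module Columns {X : Set} {N : ℕ} (enc : X ↣ Fin N) (α β : X ↔ X)
               (comm : ∀ x → Inverse.to α (Inverse.to β x) ≡ Inverse.to β (Inverse.to α x))
               (x₀ : X) (reach : ∀ x → Star (Torus.Step enc α β) x₀ x) where
  open Squares enc α β comm x₀ reach public

  swap-step : ∀ {x y} → Torus.Step enc α β x y → Torus.Step enc β α x y
  swap-step Torus.fwdA = Torus.fwdB
  swap-step Torus.bwdA = Torus.bwdB
  swap-step Torus.fwdB = Torus.fwdA
  swap-step Torus.bwdB = Torus.bwdA

  module T′ = Torus.Coordinates enc β α (λ x → sym (comm x)) x₀ (λ x → Star.map swap-step (reach x))

  W P : ℕ
  W = T′.D
  P = T′.R

  pt-swap : ∀ i j → pt i j ≡ T′.pt j i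
  pt-swap i j = fold-comm₂ A B comm i j x₀

  -- The same points `pt i j` have two charts: `i < D`, `j < R` tells rows apart, and `i < P`,
  -- `j < W` tells columns apart.
  column-injective : ∀ i j i' j' → j < W → j' < W → i < P → i' < P → pt i j ≡ pt i' j' → i ≡ i' × j ≡ j'
  column-injective i j i' j' j<W j'<W i<P i'<P e
    with T′.pt-injective j i j' i' j<W j'<W i<P i'<P (trans (sym (pt-swap i j)) (trans e (pt-swap i' j')))
  ... | e₁ , e₂ = e₂ , e₁

  opaque
    column-coordinates : ∀ x → ∃₂ λ i j → i < P × j < W × pt i j ≡ x
    column-coordinates x with T′.coordinates x
    ... | j , i , j<W , i<P , e = i , j , i<P , j<W , trans (pt-swap i j) e

  pt-P : ∀ j → pt P j ≡ pt 0 j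
  pt-P j = T′.B^R _

  D≤P : D ≤ P
  D≤P = D≤ _ 0 T′.B^R₀

  W≤R : W ≤ R
  W≤R = T′.D≤ _ 0 B^R₀

  -- At least three columns: the zigzag joins the columns 0, 1, 2 and every further
  -- square joins one more column.
  module Staircase (w t : ℕ) (W≡ : W ≡ 3 + w) (D≡ : D ≡ W + t * 2) where
    K : ℕ
    K = 2 + t * 2

    d≡ : d ≡ K + w
    d≡ = suc-injective (trans D≡ (trans (cong (_+ t * 2) W≡) (cong (3 +_) (+-comm w (t * 2)))))

    y : ℕ → ℕ
    y h with h <? K
    ... | yes _ = alt h
    ... | no _  = 2 + (h ∸ K)

    y-low : ∀ {h} → h < K → y h ≡ alt h
    y-low {h} h<K with h <? K
    ... | yes _   = refl
    ... | no ¬h<K = contradiction h<K ¬h<K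

    y-high : ∀ j → y (K + j) ≡ 2 + j
    y-high j with (K + j) <? K
    ... | yes lt = contradiction lt (m+n≮m K j)
    ... | no _   = cong (2 +_) (m+n∸m≡n K j)

    split : ∀ h → h < K ⊎ ∃ λ j → h ≡ K + j
    split h with h <? K
    ... | yes lt = inj₁ lt
    ... | no ¬lt = inj₂ (h ∸ K , sym (m+[n∸m]≡n (≮⇒≥ ¬lt)))

    y<W : ∀ {h} → h < d → suc (y h) < W
    y<W {h} h<d with split h
    ... | inj₁ h<K rewrite y-low h<K | W≡ = s≤s (s≤s (≤-trans (alt≤1 h) (s≤s z≤n)))
    ... | inj₂ (j , refl) rewrite y-high j | W≡ = s≤s (s≤s (s≤s (+-cancelˡ-< K j w (subst (K + j <_) d≡ h<d))))

    y≢ : ∀ {h} → suc h < d → y h ≢ y (suc h)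
    y≢ {h} _ e with split h | split (suc h)
    ... | inj₁ h<K | inj₁ h'<K = alt-≢ h (trans (sym (y-low h<K)) (trans e (y-low h'<K)))
    ... | inj₂ (j , refl) | inj₁ h'<K = m+n≮m K j (<-trans (n<1+n _) h'<K)
    ... | inj₂ (j , refl) | inj₂ _ = 1+n≢n (sym (trans (sym (y-high j)) (trans e (trans (cong y (sym (+-suc K j))) (y-high (suc j))))))
    ... | inj₁ h<K | inj₂ (j , eq) = <⇒≢ (≤-trans (s≤s (alt≤1 h)) (m≤m+n 2 j))
          (trans (sym (y-low h<K)) (trans e (trans (cong y eq) (y-high j))))

    y< : ∀ {h} → h < d → suc (y h) < R
    y< h<d = <-≤-trans (y<W h<d) W≤R

    open Factors y y< y≢

    2<W : 2 < W
    2<W rewrite W≡ = m≤m+n 3 w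

    K≤d : K ≤ d
    K≤d rewrite d≡ = m≤m+n K w

    K≤P : K ≤ P
    K≤P = ≤-trans K≤d (≤-trans (n≤1+n d) D≤P)

    open Zigzag K K≤d (<-≤-trans 2<W W≤R) (λ {h} h<K → subst (λ k → k ≡ 0 ⊎ k ≡ 1) (sym (y-low h<K)) (alt-01 h))

    rise-column : ∀ {i j} → i < P → j < W → (i < d → j ≢ y i) → (i < d → j ≢ suc (y i)) → pt i j ~V pt (suc i) j
    rise-column {i} {j} i<P j<W j≢ j≢′ = rise i j
        (λ {h} h<d e → case h h<d (column-injective i j h (y h) j<W (<-trans (n<1+n _) (y<W h<d)) i<P (<-≤-trans (h<D h<d) D≤P) e))
        (λ {h} h<d e → case′ h h<d (column-injective i j h (suc (y h)) j<W (y<W h<d) i<P (<-≤-trans (h<D h<d) D≤P) e))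
      where
      case : ∀ h → h < d → i ≡ h × j ≡ y h → ⊥
      case _ h<d (refl , e) = j≢ h<d e
      case′ : ∀ h → h < d → i ≡ h × j ≡ suc (y h) → ⊥
      case′ _ h<d (refl , e) = j≢′ h<d e

    z<d : ∀ {j} → j < w → K + j < d
    z<d {j} j<w = subst (K + j <_) (sym d≡) (+-monoʳ-< K j<w)

    column-edge : ∀ {j i} → j < w → i < P → (suc j < w → i ≢ K + suc j) → i ≢ K + j → pt i (3 + j) ~V pt (suc i) (3 + j)
    column-edge {j} {i} j<w i<P i≢ i≢′ = rise-column i<P (subst (3 + j <_) (sym W≡) (+-monoʳ-< 3 j<w)) ≢y ≢1+y
      where
      ≢y : i < d → 3 + j ≢ y i
      ≢y i<d e with split i
      ... | inj₁ i<K = <⇒≢ (≤-trans (s≤s (alt≤1 i)) (m≤m+n 2 (suc j))) (trans (sym (y-low i<K)) (sym e))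
      ... | inj₂ (k , refl) with +-cancelˡ-≡ 2 (suc j) k (trans e (y-high k))
      ...   | refl = i≢ (+-cancelˡ-< K (suc j) w (subst (K + suc j <_) d≡ i<d)) refl
      ≢1+y : i < d → 3 + j ≢ suc (y i)
      ≢1+y i<d e with split i
      ... | inj₁ i<K = <⇒≢ (≤-trans (s≤s (alt≤1 i)) (m≤m+n 2 j)) (trans (sym (y-low i<K)) (sym (suc-injective e)))
      ... | inj₂ (k , refl) with +-cancelˡ-≡ 2 j k (trans (suc-injective e) (y-high k))
      ...   | refl = i≢′ refl

    column-rung : ∀ {j} → j < w → pt (K + j) (2 + j) ~V pt (K + j) (3 + j)
    column-rung {j} j<w with V-bottom (z<d j<w)
    ... | e rewrite y-high j = e

    column-rung′ : ∀ {j} → j < w → pt (suc (K + j)) (2 + j) ~V pt (suc (K + j)) (3 + j)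
    column-rung′ {j} j<w with V-top (z<d j<w)
    ... | e rewrite y-high j = e

    -- The cycles of this ladder are the columns 2, 3, ..., 2 + `w`. Column 2 is cycle number 0,
    -- since the zigzag treats it separately.
    module CL = Ladder (λ j i → pt i (2 + j)) P w (K +_) (λ j → pt-P (2 + j))
      (λ j<w → <-≤-trans (z<d j<w) (≤-trans (n≤1+n d) D≤P)) column-edge column-rung column-rung′

    outer-step : ∀ {j i} → j ≤ 2 → K ≤ i → i < P → pt i j ~V pt (suc i) j
    outer-step {j} {i} j≤2 K≤i i<P with split i
    ... | inj₁ i<K = contradiction i<K (≤⇒≯ K≤i)
    ... | inj₂ (k , refl) with k Data.Nat.≟ 0 | j Data.Nat.≟ 2 | 0 <? w
    -- The first square beyond the zigzag cuts column 2 just above height `K`; the later columns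
    -- bridge this cut.
    ...   | yes refl | yes refl | yes 0<w = CL.cut-linked 0<w
    ...   | yes refl | _ | no ¬0<w = rise-column i<P (≤-<-trans j≤2 2<W)
              (λ i<d → contradiction (+-cancelˡ-< K 0 w (subst (K + 0 <_) d≡ i<d)) ¬0<w)
              (λ i<d → contradiction (+-cancelˡ-< K 0 w (subst (K + 0 <_) d≡ i<d)) ¬0<w)
    ...   | yes refl | no j≢2 | _ = rise-column i<P (≤-<-trans j≤2 2<W)
              (λ _ e → j≢2 (trans e (y-high 0)))
              (λ _ e → <⇒≢ (s≤s j≤2) (trans e (cong suc (y-high 0))))
    ...   | no k≢0 | _ | _ = rise-column i<P (≤-<-trans j≤2 2<W)
              (λ _ e → <⇒≢ (≤-<-trans j≤2 (s≤s (s≤s (n≢0⇒n>0 k≢0)))) (trans e (y-high k)))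
              (λ _ e → <⇒≢ (≤-<-trans j≤2 (s≤s (s≤s (s≤s z≤n)))) (trans e (cong suc (y-high k))))

    outer : ∀ {j i} → j ≤ 2 → K ≤ i → i ≤ P → pt K j ~V pt i j
    outer {j} j≤2 = chain (λ i → pt i j) (outer-step j≤2)

    around : ∀ {j} → j ≤ 2 → pt K j ~V pt 0 j
    around {j} j≤2 = outer j≤2 K≤P ≤-refl ◅◅ ≡⇒linked (pt-P j)

    last : suc (t * 2) < K
    last = ≤-refl

    y₀ : y 0 ≡ 0
    y₀ = y-low {0} z<s

    y-last : y (suc (t * 2)) ≡ 1
    y-last = trans (y-low last) (alt-odd t)

    b₀~b₁ : pt 0 0 ~V pt 0 1
    b₀~b₁ = subst (λ k → pt 0 k ~V pt 0 (suc k)) y₀ (V-bottom (<-≤-trans z<s K≤d))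

    b₂~t₀ : pt 0 2 ~V pt K 0
    b₂~t₀ = subst₂ (λ k l → pt 0 (free k) ~V pt K (free l)) y₀ y-last (through last)

    -- Let bⱼ and tⱼ be the points of line j at heights 0 and `K`. The squares tie b₀b₁, t₁t₂ and
    -- b₂t₀, and each column leads from tⱼ back to bⱼ, which closes up as b₀ b₁ t₁ t₂ b₂ t₀. An odd
    -- zigzag would tie b₂ to t₂ and split off a cycle.
    bottom : ∀ {j} → j ≤ 2 → x₀ ~V pt 0 j
    bottom {0} _ = ε
    bottom {1} _ = b₀~b₁
    bottom {2} _ = reversed (around z≤n) ◅◅ reversed b₂~t₀
    bottom {suc (suc (suc _))} (s≤s (s≤s ()))

    column-linked : ∀ {j} → j ≤ 2 → ∀ {i} → i ≤ P → x₀ ~V pt i j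
    column-linked j≤2 {zero}  i≤P = bottom j≤2
    column-linked {j} j≤2 {suc i} i≤P with suc i <? K
    ... | yes i<K = bottom {2} ≤-refl ◅◅ subst (λ k → pt 0 (free k) ~V pt (suc i) j) y₀ (interior i<K j≤2)
    ... | no ¬i<K = bottom j≤2 ◅◅ reversed (around j≤2) ◅◅ outer j≤2 (≮⇒≥ ¬i<K) i≤P

    columns-linked : ∀ {j} → j ≤ w → ∀ {i} → i ≤ P → x₀ ~V pt i (2 + j)
    columns-linked {zero}  _   = column-linked ≤-refl
    columns-linked {suc j} j<w i≤P = columns-linked (<⇒≤ j<w) z≤P ◅◅ column-rung j<w
        ◅◅ reversed (CL.cycle-linked j<w z≤P) ◅◅ CL.cycle-linked j<w i≤P
      where z≤P = <⇒≤ (<-≤-trans (z<d j<w) (≤-trans (n≤1+n d) D≤P))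

    V-linked : ∀ x → x₀ ~V x
    V-linked x with column-coordinates x
    ... | i , 0 , i<P , _ , refl = column-linked z≤n (<⇒≤ i<P)
    ... | i , 1 , i<P , _ , refl = column-linked (s≤s z≤n) (<⇒≤ i<P)
    ... | i , suc (suc j) , i<P , j<W , refl =
          columns-linked (≤-pred (≤-pred (≤-pred (subst (2 + j <_) W≡ j<W)))) (<⇒≤ i<P)

    hamiltonian : HamiltonianFlip
    hamiltonian = record { S = S ; S-A = S-A ; S-B = S-B ; H-linked = H-linked ; V-linked = V-linked }

  Offset : ℕ → ℕ → Set
  Offset j e = ∀ i → pt i j ≡ pt (i + e) 0

  offset-0 : Offset 0 0
  offset-0 i = cong (λ k → pt k 0) (sym (+-identityʳ i))

  offset-P : Offset 0 P
  offset-P i = sym (trans (fold-+ x₀ A i) (cong (λ z → fold z A i) T′.B^R₀))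

  offset : ∀ j → (∃ λ e → e < P × fold x₀ A e ≡ fold x₀ B j) → ∃ λ e → e < P × Offset j e
  offset j (e , e<P , eq) = e , e<P , λ i → trans (cong (λ z → fold z A i) (sym eq)) (sym (fold-+ x₀ A i))

  -- If two lines of one column started less than `D` steps apart, a single point would have two
  -- positions in the chart `i < D`, `j < R`. So their stretches of height `D` do not overlap.
  lines-apart : ∀ {j j' e e'} → Offset j e → Offset j' e' → j ≢ j' → j < R → j' < R → e ≤ e' → e + D ≤ e'
  lines-apart {j} {j'} {e} {e'} o o' j≢j' j<R j'<R e≤e' = ≮⇒≥ λ e'<e+D →
    j≢j' (proj₂ (pt-injective (e' ∸ e) j 0 j' (+-cancelʳ-< e (e' ∸ e) D
      (subst₂ _<_ (sym (m∸n+n≡m e≤e')) (+-comm e D) e'<e+D)) z<s j<R j'<R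
      (trans (o (e' ∸ e)) (trans (cong (λ k → pt k 0) (m∸n+n≡m e≤e')) (sym (o' 0))))))

module Lines {X : Set} {N : ℕ} (enc : X ↣ Fin N) (α β : X ↔ X)
             (comm : ∀ x → Inverse.to α (Inverse.to β x) ≡ Inverse.to β (Inverse.to α x))
             (x₀ : X) (reach : ∀ x → Star (Torus.Step enc α β) x₀ x) where
  open Columns enc α β comm x₀ reach public

  module Alternating (s : ℕ) (2<R : 2 < R) where
    y : ℕ → ℕ
    y h = alt (s + h)

    y≤1 : ∀ h → y h ≤ 1
    y≤1 h = alt≤1 (s + h)

    y< : ∀ {h} → h < d → suc (y h) < R
    y< {h} _ = ≤-<-trans (s≤s (y≤1 h)) 2<R

    y≢ : ∀ {h} → suc h < d → y h ≢ y (suc h)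
    y≢ {h} _ e = alt-≢ (s + h) (trans e (cong alt (+-suc s h)))

    y-01 : ∀ {h} → h < d → y h ≡ 0 ⊎ y h ≡ 1
    y-01 {h} _ = alt-01 (s + h)

    open Factors y y< y≢ public
    open Zigzag d ≤-refl 2<R y-01 public

    hamiltonian-if : (∀ x → x₀ ~V x) → HamiltonianFlip
    hamiltonian-if V-linked = record { S = S ; S-A = S-A ; S-B = S-B ; H-linked = H-linked ; V-linked = V-linked }

    Clear : ℕ → ℕ → Set
    Clear i j = ∀ {h k} → h < d → k ≤ 2 → pt i j ≢ pt h k

    climb : ∀ j {a b} → (∀ {i} → a ≤ i → i < b → Clear i j) → ∀ {i} → a ≤ i → i ≤ b → pt a j ~V pt i j
    climb j clear = chain (λ i → pt i j) λ {i} a≤i i<b →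
      rise i j (λ {h} h<d → clear a≤i i<b h<d (m≤n⇒m≤1+n (y≤1 h))) (λ {h} h<d → clear a≤i i<b h<d (s≤s (y≤1 h)))

    off-line : ∀ {i h} k {e} → i < P → Offset k e → e + D ≤ P → h < d → i < e ⊎ d + e ≤ i → pt i 0 ≢ pt h k
    off-line {i} {h} k {e} i<P o e+D≤P h<d apart eq = outside apart
        (proj₁ (column-injective i 0 (h + e) 0 z<s z<s i<P h+e<P (trans eq (o h))))
      where
      h+e<P : h + e < P
      h+e<P = <-≤-trans (subst (h + e <_) (+-comm D e) (+-monoˡ-< e (h<D h<d))) e+D≤P
      outside : i < e ⊎ d + e ≤ i → i ≢ h + e
      outside (inj₁ i<e)   = <⇒≢ (<-≤-trans i<e (m≤n+m e h))
      outside (inj₂ d+e≤i) = >⇒≢ (<-≤-trans (+-monoˡ-< e h<d) d+e≤i)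

    segment : ∀ {j} → j ≤ 2 → x₀ ~V pt 0 (free (y 0)) → x₀ ~V pt 0 j → x₀ ~V pt d j → ∀ {h} → h ≤ d → x₀ ~V pt h j
    segment j≤2 f b t {zero}  h≤d = b
    segment {j} j≤2 f b t {suc h} h≤d with m≤n⇒m<n∨m≡n h≤d
    ... | inj₁ h<d  = f ◅◅ interior h<d j≤2
    ... | inj₂ h≡d  = t ◅◅ ≡⇒linked (cong (λ k → pt k j) (sym h≡d))

    segment₀ : ∀ {j e} → Offset j e → j ≤ 2 → x₀ ~V pt 0 (free (y 0)) → x₀ ~V pt 0 j → x₀ ~V pt d j →
               ∀ {i} → e ≤ i → i ≤ d + e → x₀ ~V pt i 0
    segment₀ {j} {e} o j≤2 f b t {i} e≤i i≤d+e =
      segment j≤2 f b t (subst (i ∸ e ≤_) (m+n∸n≡m d e) (∸-monoˡ-≤ e i≤d+e))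
        ◅◅ ≡⇒linked (trans (o (i ∸ e)) (cong (λ k → pt k 0) (m∸n+n≡m e≤i)))

  module TwoColumns (t : ℕ) (2<R : 2 < R) (W≡2 : W ≡ 2) (d≡ : d ≡ suc (t * 2)) where
    open Alternating 0 2<R

    private
      line₂ : ∃ λ e → e < P × Offset 2 e
      line₂ = offset 2 (subst (λ q → T′.InRow₀ (fold x₀ B (1 * q))) W≡2 (T′.inRow₀-multiple 1))

      e = proj₁ line₂
      o₂ = proj₂ (proj₂ line₂)

      D≤e : D ≤ e
      D≤e = lines-apart offset-0 o₂ (λ ()) z<s 2<R z≤n

      e+D≤P : e + D ≤ P
      e+D≤P = lines-apart o₂ offset-P (λ ()) 2<R z<s (<⇒≤ (proj₁ (proj₂ line₂)))

      h<P : ∀ {h} → h < d → h < P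
      h<P h<d = <-≤-trans (h<D h<d) D≤P

      h+e<P : ∀ {h} → h < d → h + e < P
      h+e<P {h} h<d = <-≤-trans (subst (h + e <_) (+-comm D e) (+-monoˡ-< e (h<D h<d))) e+D≤P

      1<W : 1 < W
      1<W = subst (1 <_) (sym W≡2) ≤-refl

      clear₀ : ∀ {i} → i < P → d ≤ i → i < e ⊎ d + e ≤ i → Clear i 0
      clear₀ i<P d≤i apart {k = 0} h<d _ = off-line 0 i<P offset-0 D≤P h<d (inj₂ (subst (_≤ _) (sym (+-identityʳ d)) d≤i))
      clear₀ {i} i<P d≤i apart {h} {1} h<d _ eq = 0≢1+n (proj₂ (column-injective i 0 h 1 z<s 1<W i<P (h<P h<d) eq))
      clear₀ i<P d≤i apart {k = 2} h<d _ = off-line 2 i<P o₂ e+D≤P h<d apart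
      clear₀ i<P d≤i apart {k = suc (suc (suc _))} h<d (s≤s (s≤s ()))

      clear₁ : ∀ {i} → i < P → d ≤ i → Clear i 1
      clear₁ {i} i<P d≤i {h} {0} h<d _ eq = 1+n≢0 (proj₂ (column-injective i 1 h 0 1<W z<s i<P (h<P h<d) eq))
      clear₁ {i} i<P d≤i {h} {1} h<d _ eq = >⇒≢ (<-≤-trans h<d d≤i) (proj₁ (column-injective i 1 h 1 1<W 1<W i<P (h<P h<d) eq))
      clear₁ {i} i<P d≤i {h} {2} h<d _ eq = 1+n≢0 (proj₂ (column-injective i 1 (h + e) 0 1<W z<s i<P (h+e<P h<d) (trans eq (o₂ h))))
      clear₁ i<P d≤i {k = suc (suc (suc _))} h<d (s≤s (s≤s ()))

      last : t * 2 < d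
      last = subst (t * 2 <_) (sym d≡) ≤-refl

      d≤P : d ≤ P
      d≤P = ≤-trans (n≤1+n d) D≤P

      b₁ : x₀ ~V pt 0 1
      b₁ = V-bottom (<-≤-trans z<s last)

      up₁ : ∀ {i} → d ≤ i → i ≤ P → pt d 1 ~V pt i 1
      up₁ = climb 1 λ d≤i i<P → clear₁ i<P d≤i

      t₁ : x₀ ~V pt d 1
      t₁ = b₁ ◅◅ ≡⇒linked (sym (pt-P 1)) ◅◅ reversed (up₁ d≤P ≤-refl)

      t₀ : x₀ ~V pt d 0
      t₀ = t₁ ◅◅ reversed (subst₂ (λ h k → pt h k ~V pt h (suc k)) (sym d≡) (alt-even t) (V-top last))

      up₀ : ∀ {i} → d ≤ i → i ≤ e → pt d 0 ~V pt i 0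
      up₀ = climb 0 λ d≤i i<e → clear₀ (<-trans i<e (proj₁ (proj₂ line₂))) d≤i (inj₁ i<e)

      b₂ : x₀ ~V pt 0 2
      b₂ = t₀ ◅◅ up₀ (≤-trans (n≤1+n d) D≤e) ≤-refl ◅◅ ≡⇒linked (sym (o₂ 0))

      t₂ : x₀ ~V pt d 2
      t₂ = b₂ ◅◅ subst₂ (λ h k → pt 0 2 ~V pt h (free k)) (sym d≡) (alt-even t) (through last)

      up₂ : ∀ {i} → d + e ≤ i → i ≤ P → pt (d + e) 0 ~V pt i 0
      up₂ = climb 0 λ d+e≤i i<P → clear₀ i<P (≤-trans (m≤m+n d e) d+e≤i) (inj₂ d+e≤i)

    V-linked : ∀ x → x₀ ~V x
    V-linked x with column-coordinates x
    ... | i , 1 , i<P , _ , refl with ≤-total i d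
    ...   | inj₁ i≤d = segment (s≤s z≤n) b₂ b₁ t₁ i≤d
    ...   | inj₂ d≤i = t₁ ◅◅ up₁ d≤i (<⇒≤ i<P)
    V-linked x | i , suc (suc j) , i<P , j<W , _ = contradiction (subst (2 + j <_) W≡2 j<W) λ { (s≤s (s≤s ())) }
    V-linked x | i , 0 , i<P , _ , refl with ≤-total i d | ≤-total i e | ≤-total i (d + e)
    ...   | inj₁ i≤d | _ | _ = segment z≤n b₂ ε t₀ i≤d
    ...   | inj₂ d≤i | inj₁ i≤e | _ = t₀ ◅◅ up₀ d≤i i≤e
    ...   | inj₂ d≤i | inj₂ e≤i | inj₁ i≤d+e = segment₀ o₂ ≤-refl b₂ b₂ t₂ e≤i i≤d+e
    ...   | inj₂ d≤i | inj₂ e≤i | inj₂ d+e≤i = t₂ ◅◅ ≡⇒linked (o₂ d) ◅◅ up₂ d+e≤i (<⇒≤ i<P)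

    hamiltonian : HamiltonianFlip
    hamiltonian = hamiltonian-if V-linked

  module OneColumn (2<R : 2 < R) (W≡1 : W ≡ 1) where

    module Ordered (s u v e e' : ℕ) (u≤2 : u ≤ 2) (v≤2 : v ≤ 2)
                   (oᵤ : Offset u e) (oᵥ : Offset v e') (u≢0 : u ≢ 0) (v≢0 : v ≢ 0) (u≢v : u ≢ v)
                   (e<e' : e < e') (e'<P : e' < P) (all : ∀ {k} → k ≤ 2 → k ≡ 0 ⊎ k ≡ u ⊎ k ≡ v) where
      open Alternating s 2<R public

      private
        u<R = ≤-<-trans u≤2 2<R
        v<R = ≤-<-trans v≤2 2<R
        D≤e : D ≤ e
        D≤e = lines-apart offset-0 oᵤ (u≢0 ∘ sym) z<s u<R z≤n
        e+D≤e' : e + D ≤ e'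
        e+D≤e' = lines-apart oᵤ oᵥ u≢v u<R v<R (<⇒≤ e<e')
        e'+D≤P : e' + D ≤ P
        e'+D≤P = lines-apart oᵥ offset-P v≢0 v<R z<s (<⇒≤ e'<P)

        d+e≤e' : d + e ≤ e'
        d+e≤e' = ≤-trans (subst (_≤ e + D) (+-comm e d) (+-monoʳ-≤ e (n≤1+n d))) e+D≤e'

        clear : ∀ {i} → i < P → d ≤ i → i < e ⊎ d + e ≤ i → i < e' ⊎ d + e' ≤ i → Clear i 0
        clear {i} i<P d≤i apart apart' {h} {k} h<d k≤2 with all k≤2
        ... | inj₁ refl        = off-line 0 i<P offset-0 D≤P h<d (inj₂ (subst (_≤ i) (sym (+-identityʳ d)) d≤i))
        ... | inj₂ (inj₁ refl) = off-line u i<P oᵤ (≤-trans e+D≤e' (<⇒≤ e'<P)) h<d apart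
        ... | inj₂ (inj₂ refl) = off-line v i<P oᵥ e'+D≤P h<d apart'

        up₀ : ∀ {i} → d ≤ i → i ≤ e → pt d 0 ~V pt i 0
        up₀ = climb 0 λ d≤i i<e → clear (<-trans i<e (<-trans e<e' e'<P)) d≤i (inj₁ i<e) (inj₁ (<-trans i<e e<e'))

        upᵤ : ∀ {i} → d + e ≤ i → i ≤ e' → pt (d + e) 0 ~V pt i 0
        upᵤ = climb 0 λ d+e≤i i<e' → clear (<-trans i<e' e'<P) (≤-trans (m≤m+n d e) d+e≤i) (inj₂ d+e≤i) (inj₁ i<e')

        upᵥ : ∀ {i} → d + e' ≤ i → i ≤ P → pt (d + e') 0 ~V pt i 0
        upᵥ = climb 0 λ d+e'≤i i<P → clear i<P (≤-trans (m≤m+n d e') d+e'≤i)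
                (inj₂ (≤-trans (+-monoʳ-≤ d (<⇒≤ e<e')) d+e'≤i)) (inj₂ d+e'≤i)

      t₀~bᵤ : pt d 0 ~V pt 0 u
      t₀~bᵤ = up₀ (≤-trans (n≤1+n d) D≤e) ≤-refl ◅◅ ≡⇒linked (sym (oᵤ 0))

      tᵤ~bᵥ : pt d u ~V pt 0 v
      tᵤ~bᵥ = ≡⇒linked (oᵤ d) ◅◅ upᵤ d+e≤e' ≤-refl ◅◅ ≡⇒linked (sym (oᵥ 0))

      tᵥ~b₀ : pt d v ~V pt 0 0
      tᵥ~b₀ = ≡⇒linked (oᵥ d) ◅◅ upᵥ (≤-trans (subst (_≤ e' + D) (+-comm e' d) (+-monoʳ-≤ e' (n≤1+n d))) e'+D≤P) ≤-refl
              ◅◅ ≡⇒linked (pt-P 0)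

      linked-if : x₀ ~V pt 0 (free (y 0)) → x₀ ~V pt d 0 → x₀ ~V pt 0 u → x₀ ~V pt d u → x₀ ~V pt 0 v → x₀ ~V pt d v →
                  ∀ x → x₀ ~V x
      linked-if f t₀ bᵤ tᵤ bᵥ tᵥ x with column-coordinates x
      ... | i , suc j , _ , j<W , _ = contradiction (subst (suc j <_) W≡1 j<W) λ { (s≤s ()) }
      ... | i , 0 , i<P , _ , refl with ≤-total i d | ≤-total i e | ≤-total i (d + e) | ≤-total i e' | ≤-total i (d + e')
      ...   | inj₁ i≤d | _ | _ | _ | _ = segment z≤n f ε t₀ i≤d
      ...   | inj₂ d≤i | inj₁ i≤e | _ | _ | _ = t₀ ◅◅ up₀ d≤i i≤e
      ...   | inj₂ d≤i | inj₂ e≤i | inj₁ i≤d+e | _ | _ = segment₀ oᵤ u≤2 f bᵤ tᵤ e≤i i≤d+e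
      ...   | inj₂ d≤i | inj₂ e≤i | inj₂ d+e≤i | inj₁ i≤e' | _ = tᵤ ◅◅ ≡⇒linked (oᵤ d) ◅◅ upᵤ d+e≤i i≤e'
      ...   | inj₂ d≤i | inj₂ e≤i | inj₂ d+e≤i | inj₂ e'≤i | inj₁ i≤d+e' = segment₀ oᵥ v≤2 f bᵥ tᵥ e'≤i i≤d+e'
      ...   | inj₂ d≤i | inj₂ e≤i | inj₂ d+e≤i | inj₂ e'≤i | inj₂ d+e'≤i = tᵥ ◅◅ ≡⇒linked (oᵥ d) ◅◅ upᵥ d+e'≤i (<⇒≤ i<P)

      hamiltonian-ordered : x₀ ~V pt 0 (free (y 0)) → x₀ ~V pt d 0 → x₀ ~V pt 0 u → x₀ ~V pt d u →
                            x₀ ~V pt 0 v → x₀ ~V pt d v → HamiltonianFlip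
      hamiltonian-ordered f t₀ bᵤ tᵤ bᵥ tᵥ = hamiltonian-if (linked-if f t₀ bᵤ tᵤ bᵥ tᵥ)

    line : ∀ j → ∃ λ e → e < P × Offset j e
    line j = offset j (subst (T′.InRow₀ ∘ fold x₀ B) (trans (cong (j *_) W≡1) (*-identityʳ j)) (T′.inRow₀-multiple j))

    0∨1∨2 : ∀ {k} → k ≤ 2 → k ≡ 0 ⊎ k ≡ 1 ⊎ k ≡ 2
    0∨1∨2 {0} _ = inj₁ refl
    0∨1∨2 {1} _ = inj₂ (inj₁ refl)
    0∨1∨2 {2} _ = inj₂ (inj₂ refl)
    0∨1∨2 {suc (suc (suc _))} (s≤s (s≤s ()))

    0∨2∨1 : ∀ {k} → k ≤ 2 → k ≡ 0 ⊎ k ≡ 2 ⊎ k ≡ 1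
    0∨2∨1 {0} _ = inj₁ refl
    0∨2∨1 {1} _ = inj₂ (inj₂ refl)
    0∨2∨1 {2} _ = inj₂ (inj₁ refl)
    0∨2∨1 {suc (suc (suc _))} (s≤s (s≤s ()))

    -- In the notation bⱼ, tⱼ for the lower and upper ends of the lines, the cycle is b₀ b₁ t₀ b₂ t₁
    -- t₂.
    module OneBeforeTwo (t : ℕ) (d≡ : d ≡ 2 + t * 2) (lt : proj₁ (line 1) < proj₁ (line 2)) where
      open Ordered 0 1 2 (proj₁ (line 1)) (proj₁ (line 2)) (s≤s z≤n) ≤-refl (proj₂ (proj₂ (line 1))) (proj₂ (proj₂ (line 2)))
        (λ ()) (λ ()) (λ ()) lt (proj₁ (proj₂ (line 2))) 0∨1∨2 public

      private
        last : suc (t * 2) < d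
        last = subst (suc (t * 2) <_) (sym d≡) ≤-refl
        b₁ : x₀ ~V pt 0 1
        b₁ = V-bottom (<-≤-trans z<s last)
        t₂ : x₀ ~V pt d 2
        t₂ = reversed tᵥ~b₀
        t₁ : x₀ ~V pt d 1
        t₁ = t₂ ◅◅ reversed (subst₂ (λ h k → pt h k ~V pt h (suc k)) (sym d≡) (alt-odd t) (V-top last))
        b₂ : x₀ ~V pt 0 2
        b₂ = t₁ ◅◅ tᵤ~bᵥ

      hamiltonian : HamiltonianFlip
      hamiltonian = hamiltonian-ordered b₂ (b₁ ◅◅ reversed t₀~bᵤ) b₁ t₁ b₂ t₂

    module TwoBeforeOne (t : ℕ) (d≡ : d ≡ 2 + t * 2) (lt : proj₁ (line 2) < proj₁ (line 1)) where
      open Ordered 1 2 1 (proj₁ (line 2)) (proj₁ (line 1)) ≤-refl (s≤s z≤n) (proj₂ (proj₂ (line 2))) (proj₂ (proj₂ (line 1)))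
        (λ ()) (λ ()) (λ ()) lt (proj₁ (proj₂ (line 1))) 0∨2∨1 public

      private
        last : suc (t * 2) < d
        last = subst (suc (t * 2) <_) (sym d≡) ≤-refl
        t₁ : x₀ ~V pt d 1
        t₁ = reversed tᵥ~b₀
        t₀ : x₀ ~V pt d 0
        t₀ = t₁ ◅◅ reversed (subst₂ (λ h k → pt h k ~V pt h (suc k)) (sym d≡) (alt-even t) (V-top last))
        b₂ : x₀ ~V pt 0 2
        b₂ = t₀ ◅◅ t₀~bᵤ
        b₁ : x₀ ~V pt 0 1
        b₁ = b₂ ◅◅ reversed (V-bottom (<-≤-trans z<s last))
        t₂ : x₀ ~V pt d 2
        t₂ = subst₂ (λ h k → pt 0 0 ~V pt h (free k)) (sym d≡) (alt-even t) (through last)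

      hamiltonian : HamiltonianFlip
      hamiltonian = hamiltonian-ordered ε t₀ b₂ t₂ b₁ t₁

    module OneRow (d≡0 : d ≡ 0) where
      open Alternating 0 2<R

      V-linked : ∀ x → x₀ ~V x
      V-linked x with column-coordinates x
      ... | i , suc j , _ , j<W , _ = contradiction (subst (suc j <_) W≡1 j<W) λ { (s≤s ()) }
      ... | i , 0 , i<P , _ , refl = climb 0 {0} {P} (λ _ _ h<d → contradiction (subst (_ <_) d≡0 h<d) λ ()) z≤n (<⇒≤ i<P)

      hamiltonian : HamiltonianFlip
      hamiltonian = hamiltonian-if V-linked

-- Factorisations into oriented 2-factors

module _ {X : Set} where
  open Inverse

  -- Quantifying over the weights φ says that the two lists of four neighbours agree as multisets.
  Factorisation : (α β f v : X ↔ X) → Set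
  Factorisation α β f v = ∀ (φ : X → ℕ) x →
    (φ (to f x) + φ (from f x)) + (φ (to v x) + φ (from v x)) ≡
    (φ (to α x) + φ (from α x)) + (φ (to β x) + φ (from β x))

  -- Together with commutativity this makes the graph simple with four neighbours at each vertex;
  -- the inequalities not listed follow by inversion, as in `B≢A⁻` and `A⁻≢B⁻`.
  record Proper (α β : X ↔ X) : Set where
    field
      A≢   : ∀ x → to α x ≢ x
      B≢   : ∀ x → to β x ≢ x
      A≢A⁻ : ∀ x → to α x ≢ from α x
      B≢B⁻ : ∀ x → to β x ≢ from β x
      A≢B  : ∀ x → to α x ≢ to β x
      A≢B⁻ : ∀ x → to α x ≢ from β x

module Oriented {X : Set} {N : ℕ} (enc : X ↣ Fin N) (α β : X ↔ X)
                (comm : ∀ x → Inverse.to α (Inverse.to β x) ≡ Inverse.to β (Inverse.to α x))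
                (proper : Proper α β) where
  open Torus enc α β
  open Proper proper public

  A⁻≢ : ∀ x → A⁻ x ≢ x
  A⁻≢ x e = A≢ x (trans (cong A (sym e)) (AA⁻ x))

  B⁻≢ : ∀ x → B⁻ x ≢ x
  B⁻≢ x e = B≢ x (trans (cong B (sym e)) (BB⁻ x))

  B≢A⁻ : ∀ x → B x ≢ A⁻ x
  B≢A⁻ x e = A≢B⁻ x (B-inj (trans (sym (comm x)) (trans (cong A e) (trans (AA⁻ x) (sym (BB⁻ x))))))

  A⁻≢B⁻ : ∀ x → A⁻ x ≢ B⁻ x
  A⁻≢B⁻ x e = A≢B (A⁻ x) (trans (AA⁻ x) (trans (sym (BB⁻ x)) (cong B (sym e))))

  swapped : Proper β α
  swapped = record { A≢ = B≢ ; B≢ = A≢ ; A≢A⁻ = B≢B⁻ ; B≢B⁻ = A≢A⁻ ; A≢B = λ x → A≢B x ∘ sym ; A≢B⁻ = B≢A⁻ }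

  module _ (S : X → Bool) (S-A : ∀ {x} → S x ≡ true → S (A x) ≡ false) (S-B : ∀ {x} → S x ≡ true → S (B x) ≡ false)
           (x₀ : X) where
    open Commuting comm
    open Flip enc α β comm S S-A

    out≢inn : ∀ x → out x ≢ inn x
    out≢inn x with S x in s₁ | S (A⁻ x) in s₂ | S (B⁻ x) in s₃ | S (A⁻ (B⁻ x)) in s₄
    ... | true  | _     | true  | _     = contradiction (trans (sym s₁) (trans (cong S (sym (BB⁻ x))) (S-B s₃))) true≢false
    ... | true  | _     | false | true  = A≢A⁻ x
    ... | true  | _     | false | false = A≢B⁻ x
    ... | false | true  | true  | _     = A≢A⁻ x ∘ sym
    ... | false | true  | false | true  = contradiction (trans (sym s₂) (trans (cong S (sym
            (trans (cong B (A⁻B⁻ x)) (BB⁻ _)))) (S-B s₄))) true≢false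
    ... | false | true  | false | false = A⁻≢B⁻ x
    ... | false | false | true  | _     = A≢B x ∘ sym
    ... | false | false | false | true  = B≢A⁻ x
    ... | false | false | false | false = B≢B⁻ x

    out≢ : ∀ x → out x ≢ x
    out≢ x with S x | S (A⁻ x)
    ... | true  | _     = A≢ x
    ... | false | true  = A⁻≢ x
    ... | false | false = B≢ x

    inn≢ : ∀ x → inn x ≢ x
    inn≢ x with S (B⁻ x) | S (A⁻ (B⁻ x))
    ... | true  | _     = A≢ x
    ... | false | true  = A⁻≢ x
    ... | false | false = B⁻≢ x

    oriented-flip : (∀ x → EqClosure Edge x₀ x) → Σ (X ↔ X) λ f →
        (∀ (φ : X → ℕ) x → φ (Inverse.to f x) + φ (Inverse.from f x) ≡ φ (out x) + φ (inn x))
      × (∀ x → Linked (Inverse.to f) x₀ x)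
    oriented-flip = Walk.orientation enc out inn adjacent-sym out≢inn out≢ inn≢ x₀

module Decompositions {X : Set} {N : ℕ} (enc : X ↣ Fin N) (α β : X ↔ X)
             (comm : ∀ x → Inverse.to α (Inverse.to β x) ≡ Inverse.to β (Inverse.to α x))
             (x₀ : X) (reach : ∀ x → Star (Torus.Step enc α β) x₀ x) (proper : Proper α β) where
  open Lines enc α β comm x₀ reach public
  private
    module OH = Oriented enc α β comm proper
    module OV = Oriented enc β α (λ x → sym (comm x)) OH.swapped
  open Inverse using (to)

  2<R : 2 < R
  2<R = go _ refl
    where
    go : ∀ r → proj₁ B-order ≡ r → 2 < suc r
    go 0 e = contradiction (subst (λ r → fold x₀ B (suc r) ≡ x₀) e B^R₀) (OH.B≢ x₀)
    go 1 e = contradiction (trans (sym (B⁻B _)) (cong B⁻ (subst (λ r → fold x₀ B (suc r) ≡ x₀) e B^R₀))) (OH.B≢B⁻ x₀)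
    go (suc (suc r)) e = s≤s (s≤s (s≤s z≤n))

  TwoHamilton OneHamilton : Set
  TwoHamilton = ∃₂ λ f v → Factorisation α β f v × (∀ x → Linked (to f) x₀ x) × (∀ x → Linked (to v) x₀ x)
  OneHamilton = ∃₂ λ f v → Factorisation α β f v × (∀ x → Linked (to f) x₀ x)

  two-hamilton-flip : HamiltonianFlip → TwoHamilton
  two-hamilton-flip F =
    let open HamiltonianFlip F
        (f , f-sum , f-linked) = OH.oriented-flip S S-A S-B x₀ H-linked
        (v , v-sum , v-linked) = OV.oriented-flip S S-B S-A x₀ V-linked
    in f , v , (λ φ x → trans (cong₂ _+_ (f-sum φ x) (v-sum φ x)) (flip-sum enc α β comm S S-A S-B φ x)) , f-linked , v-linked

  hamiltonian-flip : ∀ t → D ≡ W + t * 2 → HamiltonianFlip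
  hamiltonian-flip t D≡ = columns T′.d refl
    where
    d≡ : ∀ {q} → T′.d ≡ q → d ≡ q + t * 2
    d≡ e = trans (suc-injective D≡) (cong (_+ t * 2) e)
    module _ (W≡1 : W ≡ 1) where
      open OneColumn 2<R W≡1
      ordered : ∀ t → d ≡ 2 + t * 2 → HamiltonianFlip
      ordered t d≡ with <-cmp (proj₁ (line 1)) (proj₁ (line 2))
      ... | tri< lt _ _ = OneBeforeTwo.hamiltonian t d≡ lt
      ... | tri> _ _ gt = TwoBeforeOne.hamiltonian t d≡ gt
      ... | tri≈ _ eq _ = contradiction
        (lines-apart {1} {2} (proj₂ (proj₂ (line 1))) (proj₂ (proj₂ (line 2))) (λ ()) (<-trans (n<1+n 1) 2<R) 2<R (≤-reflexive eq))
        (subst (λ e → ¬ (proj₁ (line 1) + D ≤ e)) eq (m+1+n≰m (proj₁ (line 1))))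
    one-column : W ≡ 1 → ∀ t → d ≡ t * 2 → HamiltonianFlip
    one-column W≡1 zero    d≡0 = OneColumn.OneRow.hamiltonian 2<R W≡1 d≡0
    one-column W≡1 (suc t) d≡  = ordered W≡1 t d≡
    columns : ∀ q → T′.d ≡ q → HamiltonianFlip
    columns 0 e = one-column (cong suc e) t (d≡ e)
    columns 1 e = TwoColumns.hamiltonian t 2<R (cong suc e) (d≡ e)
    columns (suc (suc w)) e = Staircase.hamiltonian w t (cong suc e) D≡

  two-hamilton : ∀ t → D ≡ W + t * 2 → TwoHamilton
  two-hamilton t D≡ = two-hamilton-flip (hamiltonian-flip t D≡)

  module ManyRowsAndColumns (1<W : 1 < W) where
    open Alternating 0 2<R
    column₁? : ∀ x → Dec (∃ λ i → i < P × pt i 1 ≡ x)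
    column₁? x = anyUpTo? (λ i → pt i 1 ≐ x) P

    c : X → Bool
    c x = does (column₁? x)

    c-A : ∀ x → c (A x) ≡ c x
    c-A x = does-⇔ (mk⇔ back forth) (column₁? (A x)) (column₁? x)
      where
      back : (∃ λ i → i < P × pt i 1 ≡ A x) → ∃ λ i → i < P × pt i 1 ≡ x
      back (suc i , i<P , e) = i , <-trans (n<1+n i) i<P , A-inj e
      back (zero  , _   , e) = _ , n<1+n _ , A-inj (trans (pt-P 1) e)
      forth : (∃ λ i → i < P × pt i 1 ≡ x) → ∃ λ i → i < P × pt i 1 ≡ A x
      forth (i , i<P , e) with m≤n⇒m<n∨m≡n i<P
      ... | inj₁ i+1<P = suc i , i+1<P , cong A e
      ... | inj₂ i+1≡P = 0 , z<s , trans (sym (pt-P 1)) (trans (cong (λ k → pt k 1) (sym i+1≡P)) (cong A e))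

    h<P : ∀ {h} → h < d → h < P
    h<P h<d = <-≤-trans (h<D h<d) D≤P

    ∉column₁ : ∀ {h} → h < d → ∀ {i} → i < P → pt i 1 ≢ pt h 0
    ∉column₁ {h} h<d {i} i<P e = 1+n≢0 (proj₂ (column-injective i 1 h 0 1<W z<s i<P (h<P h<d) e))

    c₀ : ∀ {h} → h < d → c (pt h 0) ≡ false
    c₀ {h} h<d = dec-false (column₁? (pt h 0)) λ { (i , i<P , e) → ∉column₁ h<d i<P e }

    c₁ : ∀ {h} → h < d → c (pt h 1) ≡ true
    c₁ {h} h<d = dec-true (column₁? (pt h 1)) (h , h<P h<d , refl)

    c₂ : ∀ {h} → h < d → c (pt h 2) ≡ false
    c₂ {h} h<d = dec-false (column₁? (pt h 2)) λ { (i , i<P , e) → apart i i<P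
        (B-inj (trans (B-pt i 0) (trans e (sym (B-pt h 1))))) }
      where
      apart : ∀ i → i < P → pt i 0 ≢ pt h 1
      apart i i<P e = 0≢1+n (proj₂ (column-injective i 0 h 1 z<s 1<W i<P (h<P h<d) e))

    c-B : ∀ {x} → S x ≡ true → c (B x) ≡ not (c x)
    c-B {x} s with S-true s
    ... | h , h<d , refl with alt h | alt-01 h
    ...   | .0 | inj₁ refl = trans (cong c (B-pt h 0)) (trans (c₁ h<d) (cong not (sym (c₀ h<d))))
    ...   | .1 | inj₂ refl = trans (cong c (B-pt h 1)) (trans (c₂ h<d) (cong not (sym (c₁ h<d))))

    open V.Orientation c c-A c-B using (oriented; oriented-sum)

    hamiltonian : OneHamilton
    hamiltonian =
      let (f , f-sum , f-linked) = OH.oriented-flip S S-A S-B x₀ H-linked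
      in f , oriented , (λ φ x → trans (cong₂ _+_ (f-sum φ x) (oriented-sum φ x)) (flip-sum enc α β comm S S-A S-B φ x)) , f-linked

  -- A single row or a single column is already a Hamilton cycle, and the other permutation is then
  -- the oriented 2-factor. Otherwise `1 < W` makes columns 0 and 1 distinct, as the two-colouring
  -- requires.
  one-hamilton : OneHamilton
  one-hamilton = cases d refl T′.d refl
    where
    one-row : d ≡ 0 → ∀ x → (∃₂ λ i j → i < D × j < R × pt i j ≡ x) → Linked B x₀ x
    one-row d≡0 x (suc i , j , i<D , _ , _) = contradiction (≤-pred (subst (suc i <_) (cong suc d≡0) i<D)) λ ()
    one-row d≡0 x (0 , j , _ , _ , refl) = chain (fold x₀ B) {0} {j} (λ _ _ → EqC.return refl) z≤n ≤-refl
    one-column : T′.d ≡ 0 → ∀ x → (∃₂ λ i j → i < P × j < W × pt i j ≡ x) → Linked A x₀ x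
    one-column W≡1 x (i , suc j , _ , j<W , _) = contradiction (≤-pred (subst (suc j <_) (cong suc W≡1) j<W)) λ ()
    one-column W≡1 x (i , 0 , _ , _ , refl) = chain (fold x₀ A) {0} {i} (λ _ _ → EqC.return refl) z≤n ≤-refl
    cases : ∀ p → d ≡ p → ∀ q → T′.d ≡ q → OneHamilton
    cases zero    d≡ _       _  = β , α , (λ φ x → +-comm (φ (B x) + φ (B⁻ x)) _) , λ x → one-row d≡ x (coordinates x)
    cases (suc _) _  zero    W≡ = α , β , (λ _ _ → refl) , λ x → one-column W≡ x (column-coordinates x)
    cases (suc _) _  (suc q) W≡ = ManyRowsAndColumns.hamiltonian (subst (λ k → 1 < suc k) (sym W≡) (s≤s z<s))

even-difference : ∀ {m n} → m ≤ n → n % 2 ≡ m % 2 → ∃ λ t → n ≡ m + t * 2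
even-difference {m} {n} m≤n eq = n / 2 ∸ m / 2 , (begin
  n                                           ≡⟨ m≡m%n+[m/n]*n n 2 ⟩
  n % 2 + n / 2 * 2                           ≡⟨ cong₂ (λ r q → r + q * 2) eq (sym (m+[n∸m]≡n (/-monoˡ-≤ 2 m≤n))) ⟩
  m % 2 + (m / 2 + (n / 2 ∸ m / 2)) * 2       ≡⟨ cong (m % 2 +_) (*-distribʳ-+ 2 (m / 2) _) ⟩
  m % 2 + (m / 2 * 2 + (n / 2 ∸ m / 2) * 2)   ≡⟨ +-assoc (m % 2) _ _ ⟨
  m % 2 + m / 2 * 2 + (n / 2 ∸ m / 2) * 2     ≡⟨ cong (_+ (n / 2 ∸ m / 2) * 2) (m≡m%n+[m/n]*n m 2) ⟨
  m + (n / 2 ∸ m / 2) * 2                     ∎)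
  where open ≡-Reasoning

module _ {X : Set} {N : ℕ} (enc : X ↣ Fin N) (α β : X ↔ X)
         (comm : ∀ x → Inverse.to α (Inverse.to β x) ≡ Inverse.to β (Inverse.to α x))
         (x₀ : X) (reach : ∀ x → Star (Torus.Step enc α β) x₀ x) (proper : Proper α β) where
  private
    module P = Decompositions enc α β comm x₀ reach proper
    module Q = Decompositions enc β α (λ x → sym (comm x)) x₀ (λ x → Star.map P.swap-step (reach x))
                 (Oriented.swapped enc α β comm proper)

    -- Both are the least positive exponent of `A` leading into the `B`-orbit of `x₀`, but they come
    -- from separate searches, so minimality is applied in both directions.
    W≡D : Q.W ≡ P.D
    W≡D = ≤-antisym (Q.T′.D≤ P.d P.C P.A^D) (P.D≤ Q.T′.d Q.T′.C Q.T′.A^D)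

  two-hamilton-cycles : P.D % 2 ≡ P.W % 2 → P.TwoHamilton
  two-hamilton-cycles eq with ≤-total P.W P.D
  ... | inj₁ W≤D = let (t , D≡) = even-difference W≤D eq in P.two-hamilton t D≡
  ... | inj₂ D≤W =
    let (t , D≡) = even-difference (subst (_≤ P.W) (sym W≡D) D≤W) (trans (sym eq) (cong (_% 2) (sym W≡D)))
        (f , v , factorisation , f-linked , v-linked) = Q.two-hamilton t D≡
    in f , v , (λ φ x → trans (factorisation φ x) (+-comm (φ (P.B x) + φ (P.B⁻ x)) _)) , f-linked , v-linked

-- From permutations to Hamilton cycles

indicator : {A : Set} → Dec A → ℕ
indicator a? = if does a? then 1 else 0

indicator-⇔ : {A B : Set} (a? : Dec A) (b? : Dec B) → (A → B) → (B → A) → indicator a? ≡ indicator b?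
indicator-⇔ a? b? f g = cong (if_then 1 else 0) (does-⇔ (mk⇔ f g) a? b?)

indicator-no : {A : Set} (a? : Dec A) → ¬ A → indicator a? ≡ 0
indicator-no a? ¬a = cong (if_then 1 else 0) (dec-false a? ¬a)

module _ {k : ℕ} where
  private
    next : Fin (suc k) → Fin (suc k)
    next i = fromℕ< (m%n<n (suc (toℕ i)) (suc k))

  next-cases : ∀ i → (toℕ i < k × toℕ (next i) ≡ suc (toℕ i)) ⊎ (toℕ i ≡ k × toℕ (next i) ≡ 0)
  next-cases i with m≤n⇒m<n∨m≡n (≤-pred (Fin.toℕ<n i))
  ... | inj₁ i<k = inj₁ (i<k , trans (Fin.toℕ-fromℕ< _) (m<n⇒m%n≡m (s≤s i<k)))
  ... | inj₂ i≡k = inj₂ (i≡k , trans (Fin.toℕ-fromℕ< _) (trans (cong (λ j → suc j % suc k) i≡k) (n%n≡0 (suc k))))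

  next-injective : ∀ {i j} → next i ≡ next j → i ≡ j
  next-injective {i} {j} e with next-cases i | next-cases j
  ... | inj₁ (_ , a) | inj₁ (_ , b) = Fin.toℕ-injective (suc-injective (trans (sym a) (trans (cong toℕ e) b)))
  ... | inj₁ (_ , a) | inj₂ (_ , b) = contradiction (trans (sym a) (trans (cong toℕ e) b)) λ ()
  ... | inj₂ (_ , a) | inj₁ (_ , b) = contradiction (trans (sym a) (trans (cong toℕ e) b)) λ ()
  ... | inj₂ (a , _) | inj₂ (b , _) = Fin.toℕ-injective (trans a (sym b))

  next≢ : 0 < k → ∀ i → next i ≢ i
  next≢ 0<k i e with next-cases i
  ... | inj₁ (_ , a) = 1+n≢n (trans (sym a) (cong toℕ e))
  ... | inj₂ (a , b) = <⇒≢ 0<k (trans (sym b) (trans (cong toℕ e) a))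

countFin-none : ∀ {k} (g : Fin k → Bool) → (∀ i → g i ≡ false) → countFin g ≡ 0
countFin-none {zero}  g none = refl
countFin-none {suc k} g none rewrite none zero = countFin-none (g ∘ suc) (none ∘ suc)

countFin-single : ∀ {k} (g : Fin k → Bool) i₀ → (∀ i → i ≢ i₀ → g i ≡ false) → countFin g ≡ (if g i₀ then 1 else 0)
countFin-single g zero only = trans (cong ((if g zero then 1 else 0) +_)
  (countFin-none (g ∘ suc) (λ i → only (suc i) λ ()))) (+-identityʳ _)
countFin-single g (suc i₀) only rewrite only zero (λ ()) =
  countFin-single (g ∘ suc) i₀ λ i i≢ → only (suc i) (i≢ ∘ Fin.suc-injective)

countFin-∨ : ∀ {k} (p q : Fin k → Bool) → (∀ i → p i ≡ true → q i ≡ true → ⊥) →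
             countFin (λ i → p i ∨ q i) ≡ countFin p + countFin q
countFin-∨ {zero}  p q disj = refl
countFin-∨ {suc k} p q disj with p zero in ep | q zero in eq
... | true  | true  = ⊥-elim (disj zero ep eq)
... | true  | false = cong suc (countFin-∨ (p ∘ suc) (q ∘ suc) (disj ∘ suc))
... | false | true  = trans (cong suc (countFin-∨ (p ∘ suc) (q ∘ suc) (disj ∘ suc))) (sym (+-suc _ _))
... | false | false = countFin-∨ (p ∘ suc) (q ∘ suc) (disj ∘ suc)

does⇒ : {A : Set} (a? : Dec A) → does a? ≡ true → A
does⇒ (yes a) _ = a

module _ {V : Set} (_≟ᵥ_ : DecidableEquality V) (C : HamCycle V) (f : V → V)
         (σ-next : ∀ i → HamCycle.σ C (HamCycle.next C i) ≡ f (HamCycle.σ C i)) (f≢ : ∀ x → f x ≢ x) where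
  open HamCycle C

  private
    arcs : V → V → ℕ
    arcs u v = countFin (λ i → does (σ i ≟ᵥ u) ∧ does (σ (next i) ≟ᵥ v))

    arcs≡ : ∀ u v → arcs u v ≡ indicator (f u ≟ᵥ v)
    arcs≡ u v with Bijection.strictlySurjective ord u
    ... | i₀ , refl = trans (countFin-single _ i₀ λ i i≢ → cong (_∧ does (σ (next i) ≟ᵥ v))
                              (dec-false (σ i ≟ᵥ σ i₀) (i≢ ∘ Bijection.injective ord)))
                        (cong (if_then 1 else 0) (trans (cong (_∧ does (σ (next i₀) ≟ᵥ v)) (dec-true (σ i₀ ≟ᵥ σ i₀) refl))
                          (cong (λ z → does (z ≟ᵥ v)) (σ-next i₀))))

    ∧-true : ∀ a b → a ∧ b ≡ true → a ≡ true × b ≡ true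
    ∧-true true true refl = refl , refl

    disjoint : ∀ u v i → does (σ i ≟ᵥ u) ∧ does (σ (next i) ≟ᵥ v) ≡ true →
                         does (σ i ≟ᵥ v) ∧ does (σ (next i) ≟ᵥ u) ≡ true → ⊥
    disjoint u v i e e' with ∧-true _ _ e | ∧-true _ _ e'
    ... | a , _ | _ , b with does⇒ (σ i ≟ᵥ u) a | does⇒ (σ (next i) ≟ᵥ u) b
    ...   | σi≡u | σni≡u = f≢ u (trans (cong f (sym σi≡u)) (trans (sym (σ-next i)) σni≡u))

  -- Without fixed points, no position of the cycle satisfies both alternatives of the disjunction
  -- that is counted. On two vertices both indicators are 1, so a cycle of length two is a double
  -- edge.
  cycleMult-indicators : ∀ u v → cycleMult _≟ᵥ_ C u v ≡ indicator (f u ≟ᵥ v) + indicator (f v ≟ᵥ u)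
  cycleMult-indicators u v = trans (countFin-∨ _ _ (disjoint u v)) (cong₂ _+_ (arcs≡ u v) (arcs≡ v u))

Transitive : {X : Set} → (X → X) → Set
Transitive f = ∀ x y → Linked f x y

module _ {V : Set} {N : ℕ} (enc : V ↣ Fin N) (f : V → V) (f-inj : ∀ {x y} → f x ≡ f y → x ≡ y)
         (f-trans : Transitive f) (v₀ : V) where
  private
    ord : ∃ λ p → fold v₀ f (suc p) ≡ v₀ × InjectiveBelow (suc p) (fold v₀ f)
    ord = order enc f f-inj v₀

    module _ (p : ℕ) (closes : fold v₀ f (suc p) ≡ v₀) (below : InjectiveBelow (suc p) (fold v₀ f)) where
      σ : Fin (suc p) → V
      σ i = fold v₀ f (toℕ i)

      Visited : V → Set
      Visited v = ∃ λ k → k < suc p × fold v₀ f k ≡ v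

      visited-f : ∀ {v} → Visited v → Visited (f v)
      visited-f (k , s≤s k≤p , e) with m≤n⇒m<n∨m≡n k≤p
      ... | inj₁ k<p  = suc k , s≤s k<p , cong f e
      ... | inj₂ refl = 0 , z<s , trans (sym closes) (cong f e)

      visited-f⁻ : ∀ {v} → Visited (f v) → Visited v
      visited-f⁻ (zero  , _   , e) = p , n<1+n p , f-inj (trans closes e)
      visited-f⁻ (suc k , k<p , e) = k , <-trans (n<1+n k) k<p , f-inj e

      visited-linked : ∀ {u v} → Linked f u v → Visited u → Visited v
      visited-linked ε w = w
      visited-linked (fwd refl ◅ s) w = visited-linked s (visited-f w)
      visited-linked (bwd refl ◅ s) w = visited-linked s (visited-f⁻ w)

      σ-bijection : Fin (suc p) ⤖ V
      σ-bijection = mk⤖ ( (λ {i} {j} e → Fin.toℕ-injective (injectiveBelow⇒≡ below (Fin.toℕ<n i) (Fin.toℕ<n j) e))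
                        , λ v → let (k , k<p , e) = visited-linked (f-trans v₀ v) (0 , z<s , refl)
                                in fromℕ< k<p , λ { refl → trans (cong (fold v₀ f) (Fin.toℕ-fromℕ< k<p)) e })

      cycle : HamCycle V
      cycle = record { k = p ; ord = σ-bijection }

      cycle-next : ∀ i → HamCycle.σ cycle (HamCycle.next cycle i) ≡ f (HamCycle.σ cycle i)
      cycle-next i with next-cases i
      ... | inj₁ (_ , e) = cong (fold v₀ f) e
      ... | inj₂ (i≡p , e) = trans (cong (fold v₀ f) e) (trans (sym closes) (cong (fold v₀ f ∘ suc) (sym i≡p)))

  hamCycle : Σ (HamCycle V) λ C → ∀ i → HamCycle.σ C (HamCycle.next C i) ≡ f (HamCycle.σ C i)
  hamCycle = let (p , closes , below) = ord in cycle p closes below , cycle-next p closes below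

-- Permutations composed around a cycle of layers

module _ {X : Set} where
  open Inverse

  around : (ℕ → X ↔ X) → ℕ → X → X
  around p zero    x = x
  around p (suc i) x = to (p i) (around p i x)

  to-injective : (f : X ↔ X) → ∀ {x y} → to f x ≡ to f y → x ≡ y
  to-injective f {x} {y} e = trans (sym (strictlyInverseʳ f x)) (trans (cong (from f) e) (strictlyInverseʳ f y))

  transitive-≗ : {f g : X → X} → (∀ x → f x ≡ g x) → Transitive f → Transitive g
  transitive-≗ f≗g t x y = EqC.map (λ {u} e → trans (sym (f≗g u)) e) (t x y)

  transitive-sym : (f : X ↔ X) → Transitive (to f) → Transitive (from f)
  transitive-sym f t x y = ((λ {u} e → reversed (EqC.return (trans (cong (from f) (sym e)) (strictlyInverseʳ f u)))) EqC.⋆) (t x y)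

  transitive-conjugate : (f : X → X) (v : X ↔ X) → Transitive f → Transitive (to v ∘ f ∘ from v)
  transitive-conjugate f v t x y = subst₂ (Linked _) (strictlyInverseˡ v x) (strictlyInverseˡ v y)
    (EqC.gmap (to v) (λ {u} e → trans (cong (to v ∘ f) (strictlyInverseʳ v u)) (cong (to v) e)) (t (from v x) (from v y)))

  transitive-from : (f : X → X) (x₀ : X) → (∀ x → Linked f x₀ x) → Transitive f
  transitive-from f x₀ l x y = reversed (l x) ◅◅ l y

module LayerOrder {m : ℕ} (C : HamCycle (Fin m)) where
  open HamCycle C

  position : Fin m → Fin (suc k)
  position u = proj₁ (Bijection.strictlySurjective ord u)

  σ-position : ∀ u → σ (position u) ≡ u
  σ-position u = proj₂ (Bijection.strictlySurjective ord u)

  position-σ : ∀ i → position (σ i) ≡ i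
  position-σ i = Bijection.injective ord (σ-position (σ i))

  nextLayer : Fin m → Fin m
  nextLayer u = σ (next (position u))

  nextLayer-σ : ∀ i → σ (next i) ≡ nextLayer (σ i)
  nextLayer-σ i = cong (σ ∘ next) (sym (position-σ i))

  nextLayer-injective : ∀ {u v} → nextLayer u ≡ nextLayer v → u ≡ v
  nextLayer-injective {u} {v} e =
    trans (sym (σ-position u)) (trans (cong σ (next-injective (Bijection.injective ord e))) (σ-position v))

  nextLayer≢ : 0 < k → ∀ u → nextLayer u ≢ u
  nextLayer≢ 0<k u e = next≢ 0<k (position u) (Bijection.injective ord (trans e (sym (σ-position u))))

module Layers {X : Set} {m : ℕ} (C : HamCycle (Fin m)) (p : ℕ → X ↔ X) where
  open HamCycle C
  open LayerOrder C
  open Inverse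

  F : X × Fin m → X × Fin m
  F (x , u) = to (p (toℕ (position u))) x , nextLayer u

  F-injective : ∀ {a b} → F a ≡ F b → a ≡ b
  F-injective {x , u} {y , v} e with nextLayer-injective (cong proj₂ e)
  ... | refl = cong (_, u) (to-injective (p (toℕ (position u))) (cong proj₁ e))

  F≢ : 0 < k → ∀ a → F a ≢ a
  F≢ 0<k (x , u) e = nextLayer≢ 0<k u (cong proj₂ e)

  private
    _~_ : X × Fin m → X × Fin m → Set
    _~_ = Linked F

    F-σ : ∀ x i → F (x , σ i) ≡ (to (p (toℕ i)) x , σ (next i))
    F-σ x i = cong₂ _,_ (cong (λ j → to (p (toℕ j)) x) (position-σ i)) (sym (nextLayer-σ i))

    layer : ∀ {j} → j < suc k → Fin m
    layer j< = σ (fromℕ< j<)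

    F-layer : ∀ {j} (j< : j < suc k) (j+1< : suc j < suc k) x → F (x , layer j<) ≡ (to (p j) x , layer j+1<)
    F-layer {j} j< j+1< x = trans (F-σ x (fromℕ< j<)) (cong₂ _,_ (cong (λ i → to (p i) x) (Fin.toℕ-fromℕ< j<))
        (cong σ (Fin.toℕ-injective (trans next-j (sym (Fin.toℕ-fromℕ< j+1<))))))
      where
      next-j : toℕ (next (fromℕ< j<)) ≡ suc j
      next-j with next-cases (fromℕ< j<)
      ... | inj₁ (_ , e) = trans e (cong suc (Fin.toℕ-fromℕ< j<))
      ... | inj₂ (e , _) = contradiction (trans (sym (Fin.toℕ-fromℕ< j<)) e) (<⇒≢ (≤-pred j+1<))

    F-last : (k< : k < suc k) → ∀ x → F (x , layer k<) ≡ (to (p k) x , σ zero)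
    F-last k< x = trans (F-σ x (fromℕ< k<)) (cong₂ _,_ (cong (λ i → to (p i) x) (Fin.toℕ-fromℕ< k<))
        (cong σ (Fin.toℕ-injective next-k)))
      where
      next-k : toℕ (next (fromℕ< k<)) ≡ 0
      next-k with next-cases (fromℕ< k<)
      ... | inj₁ (lt , _) = contradiction (Fin.toℕ-fromℕ< k<) (<⇒≢ lt)
      ... | inj₂ (_ , e)  = e

    climb : ∀ {j} (j< : j < suc k) x → (x , σ zero) ~ (around p j x , layer j<)
    climb {zero}  j< x = ≡⇒linked refl
    climb {suc j} j+1< x = climb j< x ◅◅ EqC.return (F-layer j< j+1< (around p j x))
      where j< = <-trans (n<1+n j) j+1<

    full-turn : ∀ x → (x , σ zero) ~ (around p (suc k) x , σ zero)
    full-turn x = climb (n<1+n k) x ◅◅ EqC.return (F-last (n<1+n k) (around p k x))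

    descend : ∀ {j} (j< : j < suc k) x → ∃ λ x' → (x' , σ zero) ~ (x , layer j<)
    descend {zero}  j< x = x , ≡⇒linked refl
    descend {suc j} j+1< x with descend (<-trans (n<1+n j) j+1<) (from (p j) x)
    ... | x' , s = x' , s ◅◅ EqC.return (trans (F-layer (<-trans (n<1+n j) j+1<) j+1< (from (p j) x)) (cong (_, layer j+1<) (strictlyInverseˡ (p j) x)))

    base : ∀ a → ∃ λ x' → (x' , σ zero) ~ a
    base (x , u) with descend (Fin.toℕ<n (position u)) x
    ... | x' , s = x' , s ◅◅ ≡⇒linked (cong (x ,_) (trans (cong σ (Fin.fromℕ<-toℕ (position u) (Fin.toℕ<n (position u)))) (σ-position u)))

  -- Every orbit of `F` meets the layer at position 0, and one full turn acts on that layer as the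
  -- composite `around p (suc k)`.
  F-transitive : Transitive (around p (suc k)) → Transitive F
  F-transitive t a b with base a | base b
  ... | x , s | y , s' = reversed s ◅◅ EqC.gfold (EqC.isEquivalence _) (_, σ zero)
                           (λ {u} e → full-turn u ◅◅ ≡⇒linked (cong (_, σ zero) e)) (t x y) ◅◅ s'

open Inverse

-- The i-th permutation of each of the four sequences moves layer i to layer i + 1; together
-- they use every edge between the two layers once, and each sequence closes up to a single orbit.
record Colouring {X : Set} (α β : X ↔ X) (m : ℕ) : Set where
  field
    p₁ p₂ p₃ p₄ : ℕ → X ↔ X
    proper : ∀ i (φ : X → ℕ) x →
      (φ (to (p₁ i) x) + φ (to (p₂ i) x)) + (φ (to (p₃ i) x) + φ (to (p₄ i) x)) ≡
      (φ (to α x) + φ (from α x)) + (φ (to β x) + φ (from β x))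
    single₁ : Transitive (around p₁ m)
    single₂ : Transitive (around p₂ m)
    single₃ : Transitive (around p₃ m)
    single₄ : Transitive (around p₄ m)

module _ {X : Set} where

  zigzag : X ↔ X → ℕ → X ↔ X
  zigzag q zero          = q
  zigzag q (suc zero)    = ↔-sym q
  zigzag q (suc (suc i)) = zigzag q i

  zigzag-cancel : ∀ q t x → to (zigzag q (suc (t * 2))) (to (zigzag q (t * 2)) x) ≡ x
  zigzag-cancel q zero    x = strictlyInverseʳ q x
  zigzag-cancel q (suc t) x = zigzag-cancel q t x

  after₂ : X ↔ X → X ↔ X → X ↔ X → ℕ → X ↔ X
  after₂ a b q zero          = a
  after₂ a b q (suc zero)    = b
  after₂ a b q (suc (suc i)) = zigzag q i

  around₂ : ∀ a b q t x → around (after₂ a b q) (2 + t * 2) x ≡ to b (to a x)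
  around₂ a b q zero    x = refl
  around₂ a b q (suc t) x = trans (zigzag-cancel q t _) (around₂ a b q t x)

  after₃ : X ↔ X → X ↔ X → X ↔ X → X ↔ X → ℕ → X ↔ X
  after₃ a b c q zero                = a
  after₃ a b c q (suc zero)          = b
  after₃ a b c q (suc (suc zero))    = c
  after₃ a b c q (suc (suc (suc i))) = zigzag q i

  around₃ : ∀ a b c q t x → around (after₃ a b c q) (3 + t * 2) x ≡ to c (to b (to a x))
  around₃ a b c q zero    x = refl
  around₃ a b c q (suc t) x = trans (zigzag-cancel q t _) (around₃ a b c q t x)

  zigzag-proper : (α β f v : X ↔ X) → Factorisation α β f v → ∀ i (φ : X → ℕ) x →
    (φ (to (zigzag f i) x) + φ (to (zigzag (↔-sym f) i) x)) + (φ (to (zigzag v i) x) + φ (to (zigzag (↔-sym v) i) x)) ≡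
    (φ (to α x) + φ (from α x)) + (φ (to β x) + φ (from β x))
  zigzag-proper α β f v fact zero          φ x = fact φ x
  zigzag-proper α β f v fact (suc zero)    φ x = trans (cong₂ _+_ (+-comm (φ (from f x)) _) (+-comm (φ (from v x)) _)) (fact φ x)
  zigzag-proper α β f v fact (suc (suc i)) φ x = zigzag-proper α β f v fact i φ x

  odd-colouring : {α β : X ↔ X} (f v : X ↔ X) → Factorisation α β f v → Transitive (to f) → ∀ t → Colouring α β (3 + t * 2)
  odd-colouring {α} {β} f v fact f-trans t = record
    { p₁ = p₁ ; p₂ = p₂ ; p₃ = p₃ ; p₄ = p₄ ; proper = proper
    ; single₁ = transitive-≗ (λ x → sym (trans (around₃ f f⁻ f f t x) (cong (to f) (strictlyInverseʳ f x)))) f-trans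
    ; single₂ = transitive-≗ (λ x → sym (trans (around₃ f⁻ v v⁻ f⁻ t x) (strictlyInverseʳ v _))) f⁻-trans
    ; single₃ = transitive-≗ (λ x → sym (around₃ v⁻ f v v t x)) (transitive-conjugate (to f) v f-trans)
    ; single₄ = transitive-≗ (λ x → sym (trans (around₃ v v⁻ f⁻ v⁻ t x) (cong (from f) (strictlyInverseʳ v x)))) f⁻-trans
    }
    where
    f⁻ = ↔-sym f
    v⁻ = ↔-sym v
    f⁻-trans = transitive-sym f f-trans
    p₁ = after₃ f  f⁻ f  f
    p₂ = after₃ f⁻ v  v⁻ f⁻
    p₃ = after₃ v⁻ f  v  v
    p₄ = after₃ v  v⁻ f⁻ v⁻
    proper : ∀ i (φ : X → ℕ) x →
      (φ (to (p₁ i) x) + φ (to (p₂ i) x)) + (φ (to (p₃ i) x) + φ (to (p₄ i) x)) ≡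
      (φ (to α x) + φ (from α x)) + (φ (to β x) + φ (from β x))
    proper zero                φ x = trans (lemma (φ (to f x)) (φ (from f x)) (φ (to v x)) (φ (from v x))) (fact φ x)
      where lemma : ∀ a b c d → (a + b) + (d + c) ≡ (a + b) + (c + d)
            lemma = solve-∀
    proper (suc zero)          φ x = trans (lemma (φ (to f x)) (φ (from f x)) (φ (to v x)) (φ (from v x))) (fact φ x)
      where lemma : ∀ a b c d → (b + c) + (a + d) ≡ (a + b) + (c + d)
            lemma = solve-∀
    proper (suc (suc zero))    φ x = trans (lemma (φ (to f x)) (φ (from f x)) (φ (to v x)) (φ (from v x))) (fact φ x)
      where lemma : ∀ a b c d → (a + d) + (c + b) ≡ (a + b) + (c + d)
            lemma = solve-∀
    proper (suc (suc (suc i))) φ x = zigzag-proper α β f v fact i φ x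

  double : X ↔ X → (X × Bool) ↔ (X × Bool)
  double q = mk↔ₛ′ (λ (x , l) → to q x , not l) (λ (x , l) → from q x , not l)
    (λ (x , l) → cong₂ _,_ (strictlyInverseˡ q x) (not-involutive l))
    (λ (x , l) → cong₂ _,_ (strictlyInverseʳ q x) (not-involutive l))

  module _ (f : (X × Bool) ↔ (X × Bool)) (f-layer : ∀ z → proj₂ (to f z) ≡ not (proj₂ z)) where

    f⁻-layer : ∀ z → proj₂ (from f z) ≡ not (proj₂ z)
    f⁻-layer z = trans (sym (not-involutive _)) (cong not (trans (sym (f-layer (from f z))) (cong proj₂ (strictlyInverseˡ f z))))

    private
      to-layer : ∀ x l → (proj₁ (to f (x , l)) , not l) ≡ to f (x , l)
      to-layer x l = cong (proj₁ (to f (x , l)) ,_) (sym (f-layer (x , l)))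

      from-layer : ∀ x l → (proj₁ (from f (x , not l)) , l) ≡ from f (x , not l)
      from-layer x l = cong (proj₁ (from f (x , not l)) ,_) (sym (trans (f⁻-layer (x , not l)) (not-involutive l)))

    -- A layer-switching permutation of the double is a pair of permutations of `X`, one for each
    -- direction between the layers; `l` is the layer of departure.
    half : Bool → X ↔ X
    half l = mk↔ₛ′ (λ x → proj₁ (to f (x , l))) (λ x → proj₁ (from f (x , not l)))
      (λ x → cong proj₁ (trans (cong (to f) (from-layer x l)) (strictlyInverseˡ f _)))
      (λ x → cong proj₁ (trans (cong (from f) (to-layer x l)) (strictlyInverseʳ f _)))

    -- The composite is the square of `f` on layer `false`. A chain of `f`-steps is projected there
    -- by `start`, which pulls a point of layer `true` back to its predecessor; every second step
    -- then becomes trivial.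
    half-transitive : Transitive (to f) → Transitive (to (half true) ∘ to (half false))
    half-transitive t x y = EqC.gfold (EqC.isEquivalence _) start step (t (x , false) (y , false))
      where
      start : X × Bool → X
      start (x , false) = x
      start (x , true)  = from (half false) x
      step : ∀ {u v} → to f u ≡ v → Linked (to (half true) ∘ to (half false)) (start u) (start v)
      step {x , false} refl = ≡⇒linked (trans (sym (strictlyInverseʳ (half false) x)) (cong start (to-layer x false)))
      step {x , true}  refl = EqC.return (trans (cong (to (half true)) (strictlyInverseˡ (half false) x)) (cong start (to-layer x true)))

  -- Take as weight the indicator of the layer of `z`. It vanishes on the four neighbours in the
  -- double, so by the factorisation it vanishes on the images under `f` and `v`.
  factor-layer : (α β : X ↔ X) (f v : (X × Bool) ↔ (X × Bool)) → Factorisation (double α) (double β) f v →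
                 ∀ z → proj₂ (to f z) ≡ not (proj₂ z) × proj₂ (to v z) ≡ not (proj₂ z)
  factor-layer α β f v fact z@(_ , l) =
      layer (to f z) (m+n≡0⇒m≡0 (φ (to f z)) (m+n≡0⇒m≡0 (φ (to f z) + φ (from f z)) zero-sum))
    , layer (to v z) (m+n≡0⇒m≡0 (φ (to v z)) (m+n≡0⇒n≡0 (φ (to f z) + φ (from f z)) zero-sum))
    where
    φ : X × Bool → ℕ
    φ (_ , l') = indicator (l' Bool.≟ l)
    not-l : indicator (not l Bool.≟ l) ≡ 0
    not-l = indicator-no (not l Bool.≟ l) (not-¬ refl ∘ sym)
    zero-sum : (φ (to f z) + φ (from f z)) + (φ (to v z) + φ (from v z)) ≡ 0
    zero-sum = trans (fact φ z) (cong₂ _+_ (cong₂ _+_ not-l not-l) (cong₂ _+_ not-l not-l))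
    other-layer : ∀ l' l → indicator (l' Bool.≟ l) ≡ 0 → l' ≡ not l
    other-layer true  false _ = refl
    other-layer false true  _ = refl
    layer : ∀ z' → φ z' ≡ 0 → proj₂ z' ≡ not l
    layer (_ , l') = other-layer l' l

  even-colouring : {α β : X ↔ X} (f v : (X × Bool) ↔ (X × Bool)) → Factorisation (double α) (double β) f v →
                   Transitive (to f) → Transitive (to v) → ∀ t → Colouring α β (2 + t * 2)
  even-colouring {α} {β} f v fact f-trans v-trans t = record
    -- After the first two layers, pairs of mutually inverse permutations of `X` must follow. `α`
    -- and `β` supply them, since `f` and `v` act on the double.
    { p₁ = after₂ (half f fl false) (half f fl true) α
    ; p₂ = after₂ (half f⁻ fl⁻ false) (half f⁻ fl⁻ true) (↔-sym α)
    ; p₃ = after₂ (half v vl false) (half v vl true) β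
    ; p₄ = after₂ (half v⁻ vl⁻ false) (half v⁻ vl⁻ true) (↔-sym β)
    ; proper = proper
    ; single₁ = transitive-≗ (λ x → sym (around₂ _ _ _ t x)) (half-transitive f fl f-trans)
    ; single₂ = transitive-≗ (λ x → sym (around₂ _ _ _ t x)) (half-transitive f⁻ fl⁻ (transitive-sym f f-trans))
    ; single₃ = transitive-≗ (λ x → sym (around₂ _ _ _ t x)) (half-transitive v vl v-trans)
    ; single₄ = transitive-≗ (λ x → sym (around₂ _ _ _ t x)) (half-transitive v⁻ vl⁻ (transitive-sym v v-trans))
    }
    where
    f⁻ = ↔-sym f
    v⁻ = ↔-sym v
    fl  = λ z → proj₁ (factor-layer α β f v fact z)
    vl  = λ z → proj₂ (factor-layer α β f v fact z)
    fl⁻ = f⁻-layer f fl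
    vl⁻ = f⁻-layer v vl
    proper : ∀ i (φ : X → ℕ) x →
      (φ (to (after₂ (half f fl false) (half f fl true) α i) x) + φ (to (after₂ (half f⁻ fl⁻ false) (half f⁻ fl⁻ true) (↔-sym α) i) x))
        + (φ (to (after₂ (half v vl false) (half v vl true) β i) x) + φ (to (after₂ (half v⁻ vl⁻ false) (half v⁻ vl⁻ true) (↔-sym β) i) x)) ≡
      (φ (to α x) + φ (from α x)) + (φ (to β x) + φ (from β x))
    proper zero          φ x = fact (φ ∘ proj₁) (x , false)
    proper (suc zero)    φ x = fact (φ ∘ proj₁) (x , true)
    proper (suc (suc i)) φ x = zigzag-proper α β α β (λ _ _ → refl) i φ x

-- Circulant graphs

parity : ∀ k → k % 2 ≡ 0 ⊎ k % 2 ≡ 1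
parity zero          = inj₁ refl
parity (suc zero)    = inj₂ refl
parity (suc (suc k)) = parity k

not^ : ∀ k l → (k % 2 ≡ 0 → fold l not k ≡ l) × (k % 2 ≡ 1 → fold l not k ≡ not l)
not^ zero          l = (λ _ → refl) , λ ()
not^ (suc zero)    l = (λ ()) , λ _ → refl
not^ (suc (suc k)) l = (λ e → trans (not-involutive _) (proj₁ (not^ k l) e)) , λ e → trans (not-involutive _) (proj₂ (not^ k l) e)

not^-parity : ∀ j k l → fold l not j ≡ fold l not k → j % 2 ≡ k % 2
not^-parity j k l e with parity j | parity k
... | inj₁ a | inj₁ b = trans a (sym b)
... | inj₂ a | inj₂ b = trans a (sym b)
... | inj₁ a | inj₂ b = contradiction (trans (sym (proj₁ (not^ j l) a)) (trans e (proj₂ (not^ k l) b))) (not-¬ refl)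
... | inj₂ a | inj₁ b = contradiction (trans (sym (proj₁ (not^ k l) b)) (trans (sym e) (proj₂ (not^ j l) a))) (not-¬ refl)

*-odd : ∀ m a → a % 2 ≡ 1 → (m * a) % 2 ≡ m % 2
*-odd m a a-odd = trans (%-distribˡ-* m a 2) (trans (cong (λ r → (m % 2 * r) % 2) a-odd)
                    (trans (cong (_% 2) (*-identityʳ (m % 2))) (m%n%n≡m%n m 2)))

*-even : ∀ m b → b % 2 ≡ 0 → (m * b) % 2 ≡ 0
*-even m b b-even = trans (%-distribˡ-* m b 2) (trans (cong (λ r → (m % 2 * r) % 2) b-even) (cong (_% 2) (*-zeroʳ (m % 2))))

module Shifts (n' : ℕ) where
  n = suc n'

  shift : ℕ → Fin n → Fin n
  shift k g = fromℕ< (m%n<n (toℕ g + k) n)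

  toℕ-shift : ∀ k g → toℕ (shift k g) ≡ (toℕ g + k) % n
  toℕ-shift k g = Fin.toℕ-fromℕ< _

  %-+ : ∀ m k → (m % n + k) % n ≡ (m + k) % n
  %-+ m k = trans (%-distribˡ-+ (m % n) k n) (trans (cong (λ r → (r + k % n) % n) (m%n%n≡m%n m n)) (sym (%-distribˡ-+ m k n)))

  shift-shift : ∀ k l g → shift k (shift l g) ≡ shift (l + k) g
  shift-shift k l g = Fin.toℕ-injective (trans (toℕ-shift k (shift l g)) (trans (cong (λ r → (r + k) % n) (toℕ-shift l g))
    (trans (%-+ (toℕ g + l) k) (trans (cong (_% n) (+-assoc (toℕ g) l k)) (sym (toℕ-shift (l + k) g))))))

  shift-0 : ∀ g → shift 0 g ≡ g
  shift-0 g = Fin.toℕ-injective (trans (toℕ-shift 0 g) (trans (cong (_% n) (+-identityʳ (toℕ g))) (m<n⇒m%n≡m (Fin.toℕ<n g))))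

  shift-n : ∀ g → shift n g ≡ g
  shift-n g = Fin.toℕ-injective (trans (toℕ-shift n g) (trans ([m+n]%n≡m%n (toℕ g) n) (m<n⇒m%n≡m (Fin.toℕ<n g))))

  shift-injective : ∀ {k l} g → k < n → l < n → shift k g ≡ shift l g → k ≡ l
  shift-injective {k} {l} g k<n l<n e = trans (sym (recover k k<n)) (trans (cong (toℕ ∘ shift (n ∸ toℕ g)) e) (recover l l<n))
    where
    recover : ∀ k → k < n → toℕ (shift (n ∸ toℕ g) (shift k g)) ≡ k
    recover k k<n = begin
      toℕ (shift (n ∸ toℕ g) (shift k g))   ≡⟨ cong toℕ (shift-shift (n ∸ toℕ g) k g) ⟩
      toℕ (shift (k + (n ∸ toℕ g)) g)       ≡⟨ toℕ-shift (k + (n ∸ toℕ g)) g ⟩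
      (toℕ g + (k + (n ∸ toℕ g))) % n       ≡⟨ cong (λ r → (toℕ g + r) % n) (+-comm k _) ⟩
      (toℕ g + ((n ∸ toℕ g) + k)) % n       ≡⟨ cong (_% n) (sym (+-assoc (toℕ g) (n ∸ toℕ g) k)) ⟩
      (toℕ g + (n ∸ toℕ g) + k) % n         ≡⟨ cong (λ r → (r + k) % n) (m+[n∸m]≡n (<⇒≤ (Fin.toℕ<n g))) ⟩
      (n + k) % n                           ≡⟨ cong (_% n) (+-comm n k) ⟩
      (k + n) % n                           ≡⟨ [m+n]%n≡m%n k n ⟩
      k % n                                 ≡⟨ m<n⇒m%n≡m k<n ⟩
      k                                     ∎
      where open ≡-Reasoning

  shift-step : ∀ ℓ i j → JumpStep n ℓ i j → shift ℓ i ≡ j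
  shift-step ℓ i j (inj₁ e) = Fin.toℕ-injective (trans (toℕ-shift ℓ i) (trans (cong (_% n) e) (m<n⇒m%n≡m (Fin.toℕ<n j))))
  shift-step ℓ i j (inj₂ e) = Fin.toℕ-injective (trans (toℕ-shift ℓ i)
    (trans (cong (_% n) e) (trans ([m+n]%n≡m%n (toℕ j) n) (m<n⇒m%n≡m (Fin.toℕ<n j)))))

  step-shift : ∀ {ℓ} → ℓ ≤ n → ∀ i → JumpStep n ℓ i (shift ℓ i)
  step-shift {ℓ} ℓ≤n i with <-≤-connex (toℕ i + ℓ) n
  ... | inj₁ lt = inj₁ (sym (trans (toℕ-shift ℓ i) (m<n⇒m%n≡m lt)))
  ... | inj₂ n≤ = inj₂ (sym (trans (cong (_+ n) (trans (toℕ-shift ℓ i) (trans (cong (_% n) (sym (m∸n+n≡m n≤)))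
                    (trans ([m+n]%n≡m%n (toℕ i + ℓ ∸ n) n) (m<n⇒m%n≡m small))))) (m∸n+n≡m n≤)))
    where
    small : toℕ i + ℓ ∸ n < n
    small = +-cancelʳ-< n (toℕ i + ℓ ∸ n) n (subst (_< n + n) (sym (m∸n+n≡m n≤)) (+-mono-<-≤ (Fin.toℕ<n i) ℓ≤n))

  shift-inverse : ∀ {k l} → k + l ≡ n → ∀ g → shift l (shift k g) ≡ g
  shift-inverse {k} {l} e g = trans (shift-shift l k g) (trans (cong (λ s → shift s g) e) (shift-n g))

  rotation : ∀ ℓ → ℓ ≤ n → Fin n ↔ Fin n
  rotation ℓ ℓ≤n = mk↔ₛ′ (shift ℓ) (shift (n ∸ ℓ)) (shift-inverse (m∸n+n≡m ℓ≤n)) (shift-inverse (m+[n∸m]≡n ℓ≤n))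

  shift-comm : ∀ k l g → shift k (shift l g) ≡ shift l (shift k g)
  shift-comm k l g = trans (shift-shift k l g) (trans (cong (λ s → shift s g) (+-comm l k)) (sym (shift-shift l k g)))

  fold-shift : ∀ a k g → fold g (shift a) k ≡ shift (k * a) g
  fold-shift a zero    g = sym (shift-0 g)
  fold-shift a (suc k) g = trans (cong (shift a) (fold-shift a k g)) (trans (shift-shift a (k * a) g) (cong (λ s → shift s g) (+-comm (k * a) a)))

  -- Being strictly below n/2 makes the steps ℓ and n - ℓ differ, and no short jump equals the
  -- complement of another.
  Short : ℕ → Set
  Short ℓ = 1 ≤ ℓ × 2 * ℓ < n

  short< : ∀ {ℓ} → Short ℓ → ℓ < n
  short< {ℓ} (_ , 2ℓ<n) = ≤-<-trans (m≤m+n ℓ _) 2ℓ<n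

  short-∸ : ∀ {ℓ} → Short ℓ → n ∸ ℓ < n
  short-∸ {suc ℓ} _ = s≤s (m∸n≤m n' ℓ)

  short≢ : ∀ {k l} → Short k → Short l → k ≢ n ∸ l
  short≢ {k} {l} (_ , k<) (1≤l , l<) e with ≤-total k l
  ... | inj₁ k≤l = <⇒≢ (≤-<-trans (+-mono-≤ k≤l (m≤m+n l 0)) l<) k+l≡n
    where k+l≡n = trans (cong (_+ l) e) (m∸n+n≡m (<⇒≤ (short< {l} (1≤l , l<))))
  ... | inj₂ l≤k = <⇒≢ (≤-<-trans (+-monoʳ-≤ k (≤-trans l≤k (m≤m+n k 0))) k<) k+l≡n
    where k+l≡n = trans (cong (_+ l) e) (m∸n+n≡m (<⇒≤ (short< {l} (1≤l , l<))))

  module Pair (a b : ℕ) (short-a : Short a) (short-b : Short b) (a-odd : Odd a) (b-even : Even b)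
              (connected : CircConnected n (a ∷ b ∷ [])) where

    private
      a<n = short< short-a
      b<n = short< short-b

    α β : Fin n ↔ Fin n
    α = rotation a (<⇒≤ a<n)
    β = rotation b (<⇒≤ b<n)

    private
      shift≢ : ∀ {ℓ} → 1 ≤ ℓ → ℓ < n → ∀ g → shift ℓ g ≢ g
      shift≢ {suc ℓ} _ ℓ<n g e = 1+n≢0 (shift-injective g ℓ<n z<s (trans e (sym (shift-0 g))))

      a≢b : a ≢ b
      a≢b refl = contradiction (trans (sym a-odd) b-even) λ ()

    proper : Proper α β
    proper = record
      { A≢   = shift≢ (proj₁ short-a) a<n
      ; B≢   = shift≢ (proj₁ short-b) b<n
      ; A≢A⁻ = λ g e → short≢ short-a short-a (shift-injective g a<n (short-∸ short-a) e)
      ; B≢B⁻ = λ g e → short≢ short-b short-b (shift-injective g b<n (short-∸ short-b) e)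
      ; A≢B  = λ g e → a≢b (shift-injective g a<n b<n e)
      ; A≢B⁻ = λ g e → short≢ short-a short-b (shift-injective g a<n (short-∸ short-b) e)
      }

    comm : ∀ g → shift a (shift b g) ≡ shift b (shift a g)
    comm = shift-comm a b

    enc : Fin n ↣ Fin n
    enc = mk↣ id

    circ-step : ∀ {i j} → CircAdj n (a ∷ b ∷ []) i j → Torus.Step enc α β i j
    circ-step {i} {j} (here (inj₁ s)) = subst (Torus.Step enc α β i) (shift-step a i j s) Torus.fwdA
    circ-step {i} {j} (here (inj₂ s)) = subst (Torus.Step enc α β i)
      (trans (cong (shift (n ∸ a)) (sym (shift-step a j i s))) (Inverse.strictlyInverseʳ α j)) Torus.bwdA
    circ-step {i} {j} (there (here (inj₁ s))) = subst (Torus.Step enc α β i) (shift-step b i j s) Torus.fwdB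
    circ-step {i} {j} (there (here (inj₂ s))) = subst (Torus.Step enc α β i)
      (trans (cong (shift (n ∸ b)) (sym (shift-step b j i s))) (Inverse.strictlyInverseʳ β j)) Torus.bwdB

    reach : ∀ g → Star (Torus.Step enc α β) zero g
    reach g = Star.map circ-step (connected zero g)

    Γ : Set
    Γ = Fin n × Bool

    layer-index : Bool → Fin 2
    layer-index false = zero
    layer-index true  = suc zero

    layer-index-injective : ∀ {l l'} → layer-index l ≡ layer-index l' → l ≡ l'
    layer-index-injective {false} {false} _ = refl
    layer-index-injective {true}  {true}  _ = refl

    encΓ : Γ ↣ Fin (n * 2)
    encΓ = mk↣ {to = λ (g , l) → combine g (layer-index l)} λ {(g , l)} {(g' , l')} e →
      let (e₁ , e₂) = Fin.combine-injective g (layer-index l) g' (layer-index l') e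
      in cong₂ _,_ e₁ (layer-index-injective e₂)

    αΓ βΓ : Γ ↔ Γ
    αΓ = double α
    βΓ = double β

    commΓ : ∀ z → Inverse.to αΓ (Inverse.to βΓ z) ≡ Inverse.to βΓ (Inverse.to αΓ z)
    commΓ (g , l) = cong (_, not (not l)) (comm g)

    properΓ : Proper αΓ βΓ
    properΓ = record
      { A≢   = λ (g , l) e → A≢ g (cong proj₁ e)
      ; B≢   = λ (g , l) e → B≢ g (cong proj₁ e)
      ; A≢A⁻ = λ (g , l) e → A≢A⁻ g (cong proj₁ e)
      ; B≢B⁻ = λ (g , l) e → B≢B⁻ g (cong proj₁ e)
      ; A≢B  = λ (g , l) e → A≢B g (cong proj₁ e)
      ; A≢B⁻ = λ (g , l) e → A≢B⁻ g (cong proj₁ e)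
      }
      where open Proper proper

    fold-double : ∀ (q : Fin n ↔ Fin n) k g l → fold (g , l) (Inverse.to (double q)) k ≡ (fold g (Inverse.to q) k , fold l not k)
    fold-double q zero    g l = refl
    fold-double q (suc k) g l = cong (Inverse.to (double q)) (fold-double q k g l)

    fold-α : ∀ k g l → fold (g , l) (Inverse.to αΓ) k ≡ (shift (k * a) g , fold l not k)
    fold-α k g l = trans (fold-double α k g l) (cong (_, fold l not k) (fold-shift a k g))

    fold-β : ∀ k g l → fold (g , l) (Inverse.to βΓ) k ≡ (shift (k * b) g , fold l not k)
    fold-β k g l = trans (fold-double β k g l) (cong (_, fold l not k) (fold-shift b k g))

    StepΓ = Torus.Step encΓ αΓ βΓ

    climb-α : ∀ k z → Star StepΓ z (fold z (Inverse.to αΓ) k)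
    climb-α zero    z = ε
    climb-α (suc k) z = climb-α k z ◅◅ (Torus.fwdA ◅ ε)

    descend-β : ∀ k z → Star StepΓ (fold z (Inverse.to βΓ) k) z
    descend-β zero    z = ε
    descend-β (suc k) z = subst (StepΓ _) (Inverse.strictlyInverseʳ βΓ _) Torus.bwdB ◅ descend-β k z

    -- b steps of a and then a steps of -b come back to the same vertex in the other layer,
    -- since a + b is odd.
    change-layer : ∀ g l → Star StepΓ (g , l) (g , not l)
    change-layer g l = climb-α b (g , l) ◅◅ subst (λ z → Star StepΓ z (g , not l)) same (descend-β a (g , not l))
      where
      same : fold (g , not l) (Inverse.to βΓ) a ≡ fold (g , l) (Inverse.to αΓ) b
      same = trans (fold-β a g (not l)) (trans (cong₂ _,_ (cong (λ s → shift s g) (*-comm a b))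
               (trans (proj₂ (not^ a (not l)) a-odd) (trans (not-involutive l) (sym (proj₁ (not^ b l) b-even))))) (sym (fold-α b g l)))

    change-back : ∀ g l → Star StepΓ (g , not l) (g , l)
    change-back g l = subst (λ l' → Star StepΓ (g , not l) (g , l')) (not-involutive l) (change-layer g (not l))

    -- A step of the double always changes the layer, and an odd closed walk at the new vertex
    -- changes it back.
    lift-step : ∀ {g g'} → Torus.Step enc α β g g' → ∀ l → Star StepΓ (g , l) (g' , l)
    lift-step Torus.fwdA l = Torus.fwdA ◅ change-back _ l
    lift-step Torus.bwdA l = Torus.bwdA ◅ change-back _ l
    lift-step Torus.fwdB l = Torus.fwdB ◅ change-back _ l
    lift-step Torus.bwdB l = Torus.bwdB ◅ change-back _ l

    lift : ∀ {g g'} → Star (Torus.Step enc α β) g g' → Star StepΓ (g , false) (g' , false)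
    lift ε       = ε
    lift (s ◅ t) = lift-step s false ◅◅ lift t

    reachΓ : ∀ z → Star StepΓ (zero , false) z
    reachΓ (g , false) = lift (reach g)
    reachΓ (g , true)  = lift (reach g) ◅◅ change-layer g false

    private
      module M = Columns encΓ αΓ βΓ commΓ (zero , false) reachΓ

      A^D-first : (M.D * a) % n ≡ (M.C * b) % n
      A^D-first = trans (sym (toℕ-shift (M.D * a) zero)) (trans (cong (toℕ ∘ proj₁)
        (trans (sym (fold-α M.D zero false)) (trans M.A^D (fold-β M.C zero false)))) (toℕ-shift (M.C * b) zero))

      B^W : (shift (M.W * b) zero , fold false not M.W) ≡ (shift (M.T′.C * a) zero , fold false not M.T′.C)
      B^W = trans (sym (fold-β M.W zero false)) (trans M.T′.A^D (fold-α M.T′.C zero false))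

      B^W-first : (M.W * b) % n ≡ (M.T′.C * a) % n
      B^W-first = trans (sym (toℕ-shift (M.W * b) zero)) (trans (cong (toℕ ∘ proj₁) B^W) (toℕ-shift (M.T′.C * a) zero))

      A^n≡B^n : fold (zero , false) (Inverse.to αΓ) n ≡ fold (zero , false) (Inverse.to βΓ) n
      A^n≡B^n = trans (fold-α n zero false) (trans (cong (_, fold false not n) (Fin.toℕ-injective
          (trans (toℕ-shift (n * a) zero) (trans (zero-mod a) (sym (trans (toℕ-shift (n * b) zero) (zero-mod b)))))))
          (sym (fold-β n zero false)))
        where
        zero-mod : ∀ c → (n * c) % n ≡ 0
        zero-mod c = trans (cong (_% n) (*-comm n c)) (m*n%n≡0 c n)

      divisor-odd : ∀ {e} → n % 2 ≡ 1 → e ∣ n → e % 2 ≡ 1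
      divisor-odd {e} n-odd e∣n with parity e
      ... | inj₂ odd  = odd
      ... | inj₁ even = contradiction (trans (sym n-odd) (n∣m⇒m%n≡0 n 2 (∣-trans (m%n≡0⇒n∣m e 2 even) e∣n))) λ ()

    -- For even n, reduce modulo 2: `A^D-first` makes `D` even, because a is odd and b is even.
    -- Likewise `B^W-first` makes the twist `T′.C` even, and comparing layers in `B^W` gives `W` the
    -- parity of `T′.C`. For odd n, the n-th powers of both permutations agree at the base point, so
    -- `D` and `W` divide n and are odd.
    same-parity : M.D % 2 ≡ M.W % 2
    same-parity = cases (parity n)
      where
      module _ (n-even : n % 2 ≡ 0) where
        2∣n : 2 ∣ n
        2∣n = m%n≡0⇒n∣m n 2 n-even
        halve : ∀ {x y} → x % n ≡ y % n → x % 2 ≡ y % 2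
        halve {x} {y} e = trans (sym (m∣n⇒o%n%m≡o%m 2 n x 2∣n)) (trans (cong (_% 2) e) (m∣n⇒o%n%m≡o%m 2 n y 2∣n))
        D-even : M.D % 2 ≡ 0
        D-even = trans (sym (*-odd M.D a a-odd)) (trans (halve {M.D * a} {M.C * b} A^D-first) (*-even M.C b b-even))
        C-even : M.T′.C % 2 ≡ 0
        C-even = trans (sym (*-odd M.T′.C a a-odd)) (trans (sym (halve {M.W * b} {M.T′.C * a} B^W-first)) (*-even M.W b b-even))
      cases : n % 2 ≡ 0 ⊎ n % 2 ≡ 1 → M.D % 2 ≡ M.W % 2
      cases (inj₁ n-even) = trans (D-even n-even)
        (sym (trans (not^-parity M.W M.T′.C false (cong proj₂ B^W)) (C-even n-even)))
      cases (inj₂ n-odd) = trans (divisor-odd n-odd (M.D∣ (subst M.InRow₀ (sym A^n≡B^n) (M.inRow₀ n))))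
        (sym (divisor-odd n-odd (M.T′.D∣ (subst M.T′.InRow₀ A^n≡B^n (M.T′.inRow₀ n)))))

    colouring : ∀ k → Colouring α β (2 + k)
    colouring k with parity k
    ... | inj₁ even =
      let (f , v , fact , f-linked , v-linked) = two-hamilton-cycles encΓ αΓ βΓ commΓ (zero , false) reachΓ properΓ same-parity
      in subst (Colouring α β) (cong (2 +_) (sym (trans (m≡m%n+[m/n]*n k 2) (cong (_+ k / 2 * 2) even))))
           (even-colouring f v fact (transitive-from _ _ f-linked) (transitive-from _ _ v-linked) (k / 2))
    ... | inj₂ odd =
      let (f , v , fact , f-linked) = Decompositions.one-hamilton enc α β comm zero reach proper
      in subst (Colouring α β) (cong (2 +_) (sym (trans (m≡m%n+[m/n]*n k 2) (cong (_+ k / 2 * 2) odd))))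
           (odd-colouring f v fact (transitive-from _ _ f-linked) (k / 2))

-- Counting edges and assembling the decomposition

indicator-× : {A B C : Set} (a? : Dec A) (b? : Dec B) (c? : Dec C) → (C → A × B) → (A → B → C) →
              indicator c? ≡ indicator a? * indicator b?
indicator-× (yes a) (yes b) c? f g = indicator-⇔ c? (yes a) (proj₁ ∘ f) (λ _ → g a b)
indicator-× (yes a) (no ¬b) c? f g = indicator-no c? (¬b ∘ proj₂ ∘ f)
indicator-× (no ¬a) b?      c? f g = indicator-no c? (¬a ∘ proj₁ ∘ f)

indicator-⊎ : {A B C : Set} (a? : Dec A) (b? : Dec B) (c? : Dec C) → (C → A ⊎ B) → (A → C) → (B → C) → (A → ¬ B) →
              indicator c? ≡ indicator a? + indicator b?
indicator-⊎ (yes a) (yes b) c? f g h disjoint = contradiction b (disjoint a)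
indicator-⊎ (yes a) (no ¬b) c? f g h disjoint = indicator-⇔ c? (yes a) (λ _ → a) g
indicator-⊎ {A} {B} {C} (no ¬a) b? c? f g h disjoint = indicator-⇔ c? b? (right ∘ f) h
  where
  right : A ⊎ B → B
  right (inj₁ a) = contradiction a ¬a
  right (inj₂ b) = b

module _ {V : Set} (_≟ᵥ_ : DecidableEquality V) where

  decomposable-≗ : {μ ν : V → V → ℕ} → (∀ u v → μ u v ≡ ν u v) → HCDecomposable _≟ᵥ_ μ → HCDecomposable _≟ᵥ_ ν
  decomposable-≗ μ≗ν (Cs , e) = Cs , λ u v → trans (e u v) (μ≗ν u v)

  decomposable-0 : HCDecomposable _≟ᵥ_ λ _ _ → 0
  decomposable-0 = [] , λ _ _ → refl

  decomposable-+ : {μ ν : V → V → ℕ} → HCDecomposable _≟ᵥ_ μ → HCDecomposable _≟ᵥ_ ν →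
                   HCDecomposable _≟ᵥ_ λ u v → μ u v + ν u v
  decomposable-+ (Cs , e) (Ds , e') = Cs ++ Ds , λ u v →
    trans (cong sum (map-++ _ Cs Ds)) (trans (sum-++ (map _ Cs) (map _ Ds)) (cong₂ _+_ (e u v) (e' u v)))

-- A cycle on one vertex would contribute a loop to `cycleMult`. What remains has at least two
-- layers, as `colouring` expects.
positive-length : ∀ {m} (C : HamCycle (Fin m)) → (∀ x → cycleMult _≟_ C x x ≡ 0) → 0 < HamCycle.k C
positive-length C loopless = n≢0⇒n>0 λ k≡0 → 1+n≢0 (trans (sym (loop C k≡0)) (loopless (HamCycle.σ C zero)))
  where
  loop : ∀ {m} (C : HamCycle (Fin m)) → HamCycle.k C ≡ 0 → cycleMult _≟_ C (HamCycle.σ C zero) (HamCycle.σ C zero) ≡ 1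
  loop record { k = .0 ; ord = ord } refl rewrite dec-true (Bijection.to ord zero ≟ Bijection.to ord zero) refl = refl

module Circulant (n' : ℕ) where
  open Shifts n'

  module _ {m : ℕ} (C : HamCycle (Fin m)) (0<k : 0 < HamCycle.k C) where
    open HamCycle C using (k; σ)

    V : Set
    V = Fin n × Fin m

    _≟ᵥ_ : DecidableEquality V
    _≟ᵥ_ = ≡-dec _≟_ _≟_

    encᵥ : V ↣ Fin (n * m)
    encᵥ = mk↣ {to = λ (g , x) → combine g x} λ {(g , x)} {(h , y)} e →
      let (e₁ , e₂) = Fin.combine-injective g x h y e in cong₂ _,_ e₁ e₂

    private
      module L (p : ℕ → Fin n ↔ Fin n) = Layers C p

    open LayerOrder C

    layer : Fin m → ℕ
    layer x = toℕ (position x)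

    arc : (ℕ → Fin n ↔ Fin n) → V → V → ℕ
    arc p (g , x) (h , y) = indicator (Inverse.to (p (layer x)) g ≟ h) * indicator (nextLayer x ≟ y)

    layered-cycle : (p : ℕ → Fin n ↔ Fin n) → Transitive (around p (suc k)) →
                    Σ (HamCycle V) λ D → ∀ u v → cycleMult _≟ᵥ_ D u v ≡ arc p u v + arc p v u
    layered-cycle p single =
      let (D , D-next) = hamCycle encᵥ (L.F p) (L.F-injective p) (L.F-transitive p single) (zero , σ zero)
      in D , λ u v → trans (cycleMult-indicators _≟ᵥ_ D (L.F p) D-next (L.F≢ p 0<k) u v) (cong₂ _+_ (split u v) (split v u))
      where
      split : ∀ u v → indicator (L.F p u ≟ᵥ v) ≡ arc p u v
      split (g , x) (h , y) = indicator-× (Inverse.to (p (layer x)) g ≟ h) (nextLayer x ≟ y) (L.F p (g , x) ≟ᵥ (h , y))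
        (λ e → cong proj₁ e , cong proj₂ e) (cong₂ _,_)

    cycleMult-C : ∀ x y → cycleMult _≟_ C x y ≡ indicator (nextLayer x ≟ y) + indicator (nextLayer y ≟ x)
    cycleMult-C = cycleMult-indicators _≟_ C nextLayer nextLayer-σ (nextLayer≢ 0<k)

    module _ (α β : Fin n ↔ Fin n) where
      open Inverse

      weight : Fin n → Fin n → ℕ
      weight g h = (indicator (to α g ≟ h) + indicator (from α g ≟ h)) + (indicator (to β g ≟ h) + indicator (from β g ≟ h))

      weight-sym : ∀ g h → weight g h ≡ weight h g
      weight-sym g h = cong₂ _+_ (pair α) (pair β)
        where
        pair : (q : Fin n ↔ Fin n) → indicator (to q g ≟ h) + indicator (from q g ≟ h) ≡ indicator (to q h ≟ g) + indicator (from q h ≟ g)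
        pair q = trans (cong₂ _+_
            (indicator-⇔ (to q g ≟ h) (from q h ≟ g) (λ e → trans (cong (from q) (sym e)) (strictlyInverseʳ q g))
                                                     (λ e → trans (cong (to q) (sym e)) (strictlyInverseˡ q h)))
            (indicator-⇔ (from q g ≟ h) (to q h ≟ g) (λ e → trans (cong (to q) (sym e)) (strictlyInverseˡ q g))
                                                     (λ e → trans (cong (from q) (sym e)) (strictlyInverseʳ q h))))
                       (+-comm (indicator (from q h ≟ g)) _)

      -- Over an edge of `C` the product edges correspond to arcs in its forward direction, and the
      -- four permutations of that layer use each of them once. The symmetry of `weight` lets the
      -- arcs counted from either end be added.
      coloured-decomposable : Colouring α β (suc k) →
        HCDecomposable _≟ᵥ_ λ (g , x) (h , y) → weight g h * cycleMult _≟_ C x y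
      coloured-decomposable colouring =
        let (D₁ , e₁) = layered-cycle p₁ single₁
            (D₂ , e₂) = layered-cycle p₂ single₂
            (D₃ , e₃) = layered-cycle p₃ single₃
            (D₄ , e₄) = layered-cycle p₄ single₄
        in D₁ ∷ D₂ ∷ D₃ ∷ D₄ ∷ [] , λ u v →
             trans (cong₂ _+_ (e₁ u v) (cong₂ _+_ (e₂ u v) (cong₂ _+_ (e₃ u v) (cong (_+ 0) (e₄ u v))))) (total u v)
        where
        open Colouring colouring

        arcs : ∀ g x h y → (arc p₁ (g , x) (h , y) + arc p₂ (g , x) (h , y)) + (arc p₃ (g , x) (h , y) + arc p₄ (g , x) (h , y)) ≡
               weight g h * indicator (nextLayer x ≟ y)
        arcs g x h y = trans (factor (used p₁) (used p₂) (used p₃) (used p₄) (indicator (nextLayer x ≟ y)))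
            (cong (_* indicator (nextLayer x ≟ y)) (proper (layer x) (λ z → indicator (z ≟ h)) g))
          where
          used : (ℕ → Fin n ↔ Fin n) → ℕ
          used p = indicator (to (p (layer x)) g ≟ h)
          factor : ∀ a b c d s → (a * s + b * s) + (c * s + d * s) ≡ ((a + b) + (c + d)) * s
          factor = solve-∀

        total : ∀ (u v : V) → (arc p₁ u v + arc p₁ v u) + ((arc p₂ u v + arc p₂ v u) +
                  ((arc p₃ u v + arc p₃ v u) + ((arc p₄ u v + arc p₄ v u) + 0))) ≡
                  weight (proj₁ u) (proj₁ v) * cycleMult _≟_ C (proj₂ u) (proj₂ v)
        total u@(g , x) v@(h , y) = trans
          (regroup (arc p₁ u v) (arc p₁ v u) (arc p₂ u v) (arc p₂ v u) (arc p₃ u v) (arc p₃ v u) (arc p₄ u v) (arc p₄ v u))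
          (trans (cong₂ _+_ (arcs g x h y) (trans (arcs h y g x) (cong (_* indicator (nextLayer y ≟ x)) (weight-sym h g))))
            (trans (sym (*-distribˡ-+ (weight g h) _ _)) (cong (weight g h *_) (sym (cycleMult-C x y)))))
          where
          regroup : ∀ a a' b b' c c' d d' → (a + a') + ((b + b') + ((c + c') + ((d + d') + 0))) ≡
                    ((a + b) + (c + d)) + ((a' + b') + (c' + d'))
          regroup = solve-∀

  jump-adjacent : ∀ {ℓ} (ℓ≤n : ℓ ≤ n) {g h} → CircAdj n (ℓ ∷ []) g h → shift ℓ g ≡ h ⊎ shift (n ∸ ℓ) g ≡ h
  jump-adjacent {ℓ} ℓ≤n {g} {h} (here (inj₁ s)) = inj₁ (shift-step ℓ g h s)
  jump-adjacent {ℓ} ℓ≤n {g} {h} (here (inj₂ s)) = inj₂ (trans (cong (shift (n ∸ ℓ)) (sym (shift-step ℓ h g s)))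
    (Inverse.strictlyInverseʳ (rotation ℓ ℓ≤n) h))

  adjacent-jump : ∀ {ℓ} (ℓ≤n : ℓ ≤ n) {g h} → shift ℓ g ≡ h → CircAdj n (ℓ ∷ []) g h
  adjacent-jump ℓ≤n {g} refl = here (inj₁ (step-shift ℓ≤n g))

  adjacent-jump⁻ : ∀ {ℓ} (ℓ≤n : ℓ ≤ n) {g h} → shift (n ∸ ℓ) g ≡ h → CircAdj n (ℓ ∷ []) g h
  adjacent-jump⁻ {ℓ} ℓ≤n {g} refl = here (inj₂ (subst (JumpStep n ℓ (shift (n ∸ ℓ) g))
    (Inverse.strictlyInverseˡ (rotation ℓ ℓ≤n) g) (step-shift ℓ≤n (shift (n ∸ ℓ) g))))

  jump-unique : ∀ {k l} → Short k → Short l → ∀ {g h} → CircAdj n (k ∷ []) g h → CircAdj n (l ∷ []) g h → k ≡ l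
  jump-unique {k} {l} sk sl {g} c c' with jump-adjacent (<⇒≤ (short< sk)) c | jump-adjacent (<⇒≤ (short< sl)) c'
  ... | inj₁ e | inj₁ e' = shift-injective g (short< sk) (short< sl) (trans e (sym e'))
  ... | inj₁ e | inj₂ e' = contradiction (shift-injective g (short< sk) (short-∸ sl) (trans e (sym e'))) (short≢ sk sl)
  ... | inj₂ e | inj₁ e' = contradiction (sym (shift-injective g (short-∸ sk) (short< sl) (trans e (sym e')))) (short≢ sl sk)
  ... | inj₂ e | inj₂ e' = ∸-cancelˡ-≡ (<⇒≤ (short< sk)) (<⇒≤ (short< sl)) (shift-injective g (short-∸ sk) (short-∸ sl) (trans e (sym e')))

  circMult-jump : ∀ {ℓ} (s : Short ℓ) g h → circMult n (ℓ ∷ []) g h ≡ indicator (shift ℓ g ≟ h) + indicator (shift (n ∸ ℓ) g ≟ h)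
  circMult-jump {ℓ} s g h = indicator-⊎ (shift ℓ g ≟ h) (shift (n ∸ ℓ) g ≟ h) (circAdj? n (ℓ ∷ []) g h)
      (jump-adjacent ℓ≤n) (adjacent-jump ℓ≤n) (adjacent-jump⁻ ℓ≤n)
      λ e e' → short≢ s s (shift-injective g (short< s) (short-∸ s) (trans e (sym e')))
    where ℓ≤n = <⇒≤ (short< s)

  adjacent-member : ∀ {L g h} → CircAdj n L g h → ∃ λ ℓ → ℓ ∈ L × CircAdj n (ℓ ∷ []) g h
  adjacent-member (here s)  = _ , here refl , here s
  adjacent-member (there c) = let (ℓ , ℓ∈L , c') = adjacent-member c in ℓ , there ℓ∈L , c'

  -- `circMult` never exceeds 1, so it adds up over the jumps only because no edge arises from two
  -- different short jumps (`jump-unique`).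
  circMult-sum : ∀ {L} → Unique L → (∀ {ℓ} → ℓ ∈ L → Short ℓ) → ∀ g h →
                 circMult n L g h ≡ sum (map (λ ℓ → circMult n (ℓ ∷ []) g h) L)
  circMult-sum {[]}    _            short g h = refl
  circMult-sum {ℓ ∷ L} (ℓ∉L ∷ uniq) short g h = trans
    (indicator-⊎ (circAdj? n (ℓ ∷ []) g h) (circAdj? n L g h) (circAdj? n (ℓ ∷ L) g h)
      (λ { (here s) → inj₁ (here s) ; (there c) → inj₂ c }) (λ { (here s) → here s ; (there ()) }) there
      λ c c' → let (ℓ' , ℓ'∈L , c'') = adjacent-member c'
               in lookup ℓ∉L ℓ'∈L (jump-unique (short (here refl)) (short (there ℓ'∈L)) c c''))
    (cong (circMult n (ℓ ∷ []) g h +_) (circMult-sum uniq (short ∘ there) g h))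

  Good : ℕ × ℕ → Set
  Good (a , b) = Short a × Short b × Odd a × Even b × CircConnected n (a ∷ b ∷ [])

  pairMult : ℕ × ℕ → Fin n → Fin n → ℕ
  pairMult (a , b) g h = circMult n (a ∷ []) g h + circMult n (b ∷ []) g h

  module _ {m : ℕ} (C : HamCycle (Fin m)) (0<k : 0 < HamCycle.k C) where

    pair-decomposable : ∀ p → Good p →
      HCDecomposable (≡-dec _≟_ _≟_) λ (g , x) (h , y) → pairMult p g h * cycleMult _≟_ C x y
    pair-decomposable (a , b) (sa , sb , a-odd , b-even , connected) = decomposable-≗ (≡-dec _≟_ _≟_)
        (λ (g , x) (h , y) → cong (_* cycleMult _≟_ C x y) (sym (cong₂ _+_ (circMult-jump sa g h) (circMult-jump sb g h))))
        -- `C` has `suc k` layers; `0<k` allows writing this number as 2 + `pred k`.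
        (coloured-decomposable C 0<k α β (subst (Colouring α β) (cong suc (suc-pred k ⦃ >-nonZero 0<k ⦄)) (colouring (pred k))))
      where
      open HamCycle C using (k)
      open Pair a b sa sb a-odd b-even connected

    pairs-decomposable : ∀ P → (∀ {p} → p ∈ P → Good p) →
      HCDecomposable (≡-dec _≟_ _≟_) λ (g , x) (h , y) → sum (map (λ p → pairMult p g h) P) * cycleMult _≟_ C x y
    pairs-decomposable []      good = decomposable-0 (≡-dec _≟_ _≟_)
    pairs-decomposable (p ∷ P) good = decomposable-≗ (≡-dec _≟_ _≟_)
      (λ (g , x) (h , y) → sym (*-distribʳ-+ (cycleMult _≟_ C x y) (pairMult p g h) _))
      (decomposable-+ (≡-dec _≟_ _≟_) (pair-decomposable p (good (here refl))) (pairs-decomposable P (good ∘ there)))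

  cycles-decomposable : ∀ {m} P → (∀ {p} → p ∈ P → Good p) → (Cs : List (HamCycle (Fin m))) →
    (∀ x → sum (map (λ C → cycleMult _≟_ C x x) Cs) ≡ 0) →
    HCDecomposable (≡-dec _≟_ _≟_) λ (g , x) (h , y) →
      sum (map (λ p → pairMult p g h) P) * sum (map (λ C → cycleMult _≟_ C x y) Cs)
  cycles-decomposable P good []       loopless = decomposable-≗ (≡-dec _≟_ _≟_)
    (λ (g , x) (h , y) → sym (*-zeroʳ (sum (map (λ p → pairMult p g h) P)))) (decomposable-0 (≡-dec _≟_ _≟_))
  cycles-decomposable P good (C ∷ Cs) loopless = decomposable-≗ (≡-dec _≟_ _≟_)
    (λ (g , x) (h , y) → sym (*-distribˡ-+ (sum (map (λ p → pairMult p g h) P)) (cycleMult _≟_ C x y) _))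
    (decomposable-+ (≡-dec _≟_ _≟_)
      (pairs-decomposable C (positive-length C λ x → m+n≡0⇒m≡0 _ (loopless x)) P good)
      (cycles-decomposable P good Cs λ x → m+n≡0⇒n≡0 (cycleMult _≟_ C x x) (loopless x)))

  pairMult-sum : ∀ P g h → sum (map (λ p → pairMult p g h) P) ≡
                 sum (map (λ ℓ → circMult n (ℓ ∷ []) g h) (map proj₁ P ++ map proj₂ P))
  pairMult-sum P g h = trans (split P) (sym (trans (cong sum (map-++ φ (map proj₁ P) (map proj₂ P)))
                         (sum-++ (map φ (map proj₁ P)) (map φ (map proj₂ P)))))
    where
    φ : ℕ → ℕ
    φ ℓ = circMult n (ℓ ∷ []) g h
    rearrange : ∀ a b c d → (a + b) + (c + d) ≡ (a + c) + (b + d)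
    rearrange = solve-∀
    split : ∀ P → sum (map (λ p → pairMult p g h) P) ≡ sum (map φ (map proj₁ P)) + sum (map φ (map proj₂ P))
    split []            = refl
    split ((a , b) ∷ P) = trans (cong (pairMult (a , b) g h +_) (split P)) (rearrange (φ a) (φ b) _ _)

theorem1p4 : (n : ℕ) (L : List ℕ) → IsJumpSet n L → EvenRegular n L → PropertyQ n L →
    (m : ℕ) (μ : Fin m → Fin m → ℕ) →
    (∀ x y → μ x y ≡ μ y x) → (∀ x → μ x x ≡ 0) →
    HCDecomposable _≟_ μ →
    HCDecomposable (≡-dec _≟_ _≟_) (tensor (circMult n L) μ)
-- There are no vertices, so the empty list of cycles decomposes the product.
theorem1p4 zero L _ _ _ m μ _ _ _ = [] , λ { (() , _) }
theorem1p4 (suc n') L (unique , bounds) even-regular (P , P↭L , Q) m μ _ loopless (Cs , Cs-μ) =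
  decomposable-≗ (≡-dec _≟_ _≟_)
    (λ (g , x) (h , y) → cong₂ _*_
      (trans (pairMult-sum P g h) (trans (sum-↭ (map⁺ _ P↭L)) (sym (circMult-sum unique short g h)))) (Cs-μ x y))
    (cycles-decomposable P good Cs λ x → trans (Cs-μ x x) (loopless x))
  where
  open Shifts n' using (Short)
  open Circulant n'

  short : ∀ {ℓ} → ℓ ∈ L → Short ℓ
  short ℓ∈L = proj₁ (bounds ℓ∈L) , ≤∧≢⇒< (proj₂ (bounds ℓ∈L)) (even-regular ℓ∈L)

  good : ∀ {p} → p ∈ P → Good p
  good p∈P = short (∈-resp-↭ P↭L (∈-++⁺ˡ (∈-map⁺ proj₁ p∈P)))
           , short (∈-resp-↭ P↭L (∈-++⁺ʳ (map proj₁ P) (∈-map⁺ proj₂ p∈P)))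
           , Q p∈P
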